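{- Let $k \geq 1$, let $D_1,\ldots,D_k$ be division rings, let $R := D_1 \times \ldots \times D_k$ (with pointwise ring operations), and let $A \subset R$ be a non-empty finite set such that $|A+A| \leq K|A|$ and $|A \cdot A| \leq K|A|$ for some $K \geq 1$. Then one of the following holds: (i) There exists $1 \leq j \leq k$ such that $|\pi_j(A)| \ll k K^{O(1)}$, where $\pi_j: R \to D_j$ is the projection homomorphism. (ii) There exist a finite subring $S$ of $R$ of cardinality $|S| \ll K^{O(1)} |A|$ and an invertible element $a \in A$ such that $a \cdot S = S \cdot a$ and $A \subset a \cdot S + \mathbf{O}( K^{O(1)} )$.
   Context: A subring is an additive subgroup closed under multiplication (it is not required to contain the identity). For subsets $A,B$ of a ring: $A+B := \{a+b : a\in A, b\in B\}$, $A\cdot B := \{ab : a\in A, b\in B\}$; $r\cdot A := \{ra : a\in A\}$ and $A\cdot r := \{ar : a \in A\}$ for a ring element $r$. $|A|$ denotes the cardinality of a finite set $A$. $X \ll Y$ means $X \leq CY$ for some absolute constant $C$; $O(1)$ denotes a quantity bounded by an absolute constant. $\mathbf{O}(N)$ denotes an unspecified finite non-empty subset of the ring of cardinality $O(N)$; thus $A \subset a\cdot S + \mathbf{O}(K^{O(1)})$ means that there is a finite non-empty set $X \subset R$ with $|X| \leq C K^{C}$, $C$ an absolute constant, such that $A \subset a\cdot S + X$. All implied constants are absolute (independent of $k$, the $D_i$, $A$, $K$). -}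

module Defs where

open import Algebra.Bundles using (Ring)
open import Algebra.Definitions using (Invertible)
import Algebra.Definitions.RawSemiring as RawSemiringDefs
open import Data.Fin using (Fin)
import Data.Integer as ℤ
open import Data.List using (List; length)
import Data.List.Membership.Setoid as Membership
import Data.List.Relation.Unary.Unique.Setoid as UniqueSetoid
open import Data.Nat using (ℕ)
open import Data.Product using (∃-syntax; _×_; _,_; proj₁; proj₂)
open import Data.Rational as ℚ using (ℚ)
open import Function.Bundles using (_⇔_)
open import Level using (Level; _⊔_; suc; Setω)
open import Relation.Binary.Bundles using (Setoid)
open import Relation.Binary.Definitions using (_Respects_)
open import Relation.Binary.PropositionalEquality using (_≡_)
open import Relation.Nullary using (¬_)
open import Relation.Unary using (Pred; _∈_)

-- Existential quantification over a family in Setω.  It lets a constant be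
-- chosen before the universe levels of the rings are quantified, so that the
-- constant is absolute.
record ∃ω {a} (A : Set a) (B : A → Setω) : Setω where
  constructor _,ω_
  field
    witness : A
    holds   : B witness

-- Doubling constants K are taken in ℚ.  Real K ≥ 1 would give nothing
-- more: the hypotheses |A+A| ≤ K|A| and |A·A| ≤ K|A| hold for K if and only if K
-- is at least the larger of the rational numbers |A+A|/|A| and |A·A|/|A|, the
-- first of which is ≥ 1, and the conclusions are monotone in K.

fromℕ : ℕ → ℚ
fromℕ n = ℤ.+ n ℚ./ 1

open RawSemiringDefs ℚ.+-*-rawSemiring public using (_^_)

-- Subsets of a setoid are predicates.  A predicate with a cardinality
-- automatically respects _≈_, because list membership here is up to _≈_.
module Cardinality {c ℓ} (S : Setoid c ℓ) where

  open Setoid S using (Carrier)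
  open Membership S using () renaming (_∈_ to _∈ₗ_)
  open UniqueSetoid S using (Unique)

  infix 4 ∣_∣≡_ ∣_∣≤_

  ∣_∣≡_ : ∀ {p} → Pred Carrier p → ℕ → Set (c ⊔ ℓ ⊔ p)
  ∣ P ∣≡ n = ∃[ xs ] Unique xs × length xs ≡ n × (∀ x → x ∈ P ⇔ x ∈ₗ xs)

  ∣_∣≤_ : ∀ {p} → Pred Carrier p → ℚ → Set (c ⊔ ℓ ⊔ p)
  ∣ P ∣≤ q = ∃[ n ] (∣ P ∣≡ n) × fromℕ n ℚ.≤ q

module RingSubsets {c ℓ} (R : Ring c ℓ) where

  open Ring R

  infixl 6 _⊕_
  infixl 7 _⊙_ _·ˡ_ _·ʳ_

  _⊕_ : ∀ {p q} → Pred Carrier p → Pred Carrier q → Pred Carrier (c ⊔ ℓ ⊔ p ⊔ q)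
  (A ⊕ B) x = ∃[ a ] ∃[ b ] a ∈ A × b ∈ B × x ≈ a + b

  _⊙_ : ∀ {p q} → Pred Carrier p → Pred Carrier q → Pred Carrier (c ⊔ ℓ ⊔ p ⊔ q)
  (A ⊙ B) x = ∃[ a ] ∃[ b ] a ∈ A × b ∈ B × x ≈ a * b

  _·ˡ_ : ∀ {p} → Carrier → Pred Carrier p → Pred Carrier (c ⊔ ℓ ⊔ p)
  (r ·ˡ A) x = ∃[ a ] a ∈ A × x ≈ r * a

  _·ʳ_ : ∀ {p} → Pred Carrier p → Carrier → Pred Carrier (c ⊔ ℓ ⊔ p)
  (A ·ʳ r) x = ∃[ a ] a ∈ A × x ≈ a * r

  -- The identity is not required to belong to a subring.
  record IsSubring {p} (S : Pred Carrier p) : Set (c ⊔ ℓ ⊔ p) where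
    field
      resp       : S Respects _≈_
      0#-mem     : 0# ∈ S
      +-closed   : ∀ {x y} → x ∈ S → y ∈ S → x + y ∈ S
      neg-closed : ∀ {x} → x ∈ S → - x ∈ S
      *-closed   : ∀ {x y} → x ∈ S → y ∈ S → x * y ∈ S

  IsInvertible : Carrier → Set (c ⊔ ℓ)
  IsInvertible = Invertible _≈_ 1# _*_

record DivisionRing c ℓ : Set (suc (c ⊔ ℓ)) where
  field
    ring : Ring c ℓ
  open Ring ring
  field
    0≉1     : ¬ 0# ≈ 1#
    inverse : ∀ x → ¬ x ≈ 0# → Invertible _≈_ 1# _*_ x

module Product {c ℓ : Level} {k : ℕ} (D : Fin k → DivisionRing c ℓ) where

  module D (i : Fin k) = Ring (DivisionRing.ring (D i))

  productRing : Ring c ℓ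
  productRing = record
    { Carrier = ∀ i → D.Carrier i
    ; _≈_     = λ x y → ∀ i → D._≈_ i (x i) (y i)
    ; _+_     = λ x y i → D._+_ i (x i) (y i)
    ; _*_     = λ x y i → D._*_ i (x i) (y i)
    ; -_      = λ x i → D.-_ i (x i)
    ; 0#      = λ i → D.0# i
    ; 1#      = λ i → D.1# i
    ; isRing  = record
      { +-isAbelianGroup = record
        { isGroup = record
          { isMonoid = record
            { isSemigroup = record
              { isMagma = record
                { isEquivalence = record
                  { refl  = λ i → D.refl i
                  ; sym   = λ p i → D.sym i (p i)
                  ; trans = λ p q i → D.trans i (p i) (q i)
                  }
                ; ∙-cong = λ p q i → D.+-cong i (p i) (q i)
                }
              ; assoc = λ x y z i → D.+-assoc i (x i) (y i) (z i)
              }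
            ; identity = (λ x i → D.+-identityˡ i (x i))
                       , (λ x i → D.+-identityʳ i (x i))
            }
          ; inverse = (λ x i → D.-‿inverseˡ i (x i))
                    , (λ x i → D.-‿inverseʳ i (x i))
          ; ⁻¹-cong = λ p i → D.-‿cong i (p i)
          }
        ; comm = λ x y i → D.+-comm i (x i) (y i)
        }
      ; *-cong     = λ p q i → D.*-cong i (p i) (q i)
      ; *-assoc    = λ x y z i → D.*-assoc i (x i) (y i) (z i)
      ; *-identity = (λ x i → D.*-identityˡ i (x i))
                   , (λ x i → D.*-identityʳ i (x i))
      ; distrib    = (λ x y z i → D.distribˡ i (x i) (y i) (z i))
                   , (λ x y z i → D.distribʳ i (x i) (y i) (z i))
      }
    }

  open Ring productRing public using (Carrier; setoid)
  open RingSubsets productRing public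

  -- π j A is the image of A under the j-th coordinate projection.
  π : ∀ {p} (j : Fin k) → Pred Carrier p → Pred (D.Carrier j) (c ⊔ ℓ ⊔ p)
  π j A y = ∃[ x ] x ∈ A × D._≈_ j y (x j)

  module Card = Cardinality setoid
  module Cardᴰ (j : Fin k) = Cardinality (D.setoid j)

{-# OPTIONS --safe #-}

-- Fix an invertible b for which bA meets many of the dilates aA, a ∈ A, in a positive proportion
-- of A. By Ruzsa covering each of these aA is covered by few translates of b(A − A), and by
-- Petridis's lemma the set of these a contains a large X for which G = X − X is an approximate
-- group; then aG is covered by few translates of bG for every a ∈ X.
--
-- Let S_M consist of the r for which rG is covered by M translates of G. Sums and products of
-- elements of S_M lie in S_M′ with M′ polynomial in M. Conversely, if no coordinate projection of
-- A is small, then most differences of elements of A are invertible, so that by pigeonhole every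
-- r in S_M is a quotient h d⁻¹ with h ∈ G − G and d ∈ X − X invertible, for any M up to a fixed
-- power of K. As b⁻¹h and d⁻¹b lie in S_M₀ with M₀ independent of M, conjugation by b maps the
-- finite set S_M injectively into S_M₀² ⊆ S_M. Hence S = S_M = S_M₀² is a finite subring with
-- bS = Sb, and it contains b⁻¹X, so that A meets few cosets of bS.

module Submission where

open import Defs
open import Algebra.Bundles using (AbelianGroup; CommutativeMonoid; Ring)
import Algebra.Properties.AbelianGroup as AbelianGroupₚ
import Algebra.Properties.CommutativeSemigroup as CommutativeSemigroupₚ
import Algebra.Properties.Group as Groupₚ
import Algebra.Properties.Ring as Ringₚ
import Algebra.Solver.CommutativeMonoid as CommutativeMonoidSolver
import Algebra.Solver.CommutativeMonoid.Normal as CommutativeMonoidNormal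
open import Axiom.ExcludedMiddle using (ExcludedMiddle)
open import Data.Fin using (Fin; zero; #_)
import Data.Integer as ℤ
import Data.Integer.Properties as ℤ
open import Data.List using (List; []; _∷_; length; map; filter; take; deduplicate; cartesianProductWith; cartesianProduct; allFin; _++_)
import Data.List.Membership.Propositional as Prop
open Prop using (find) renaming (_∈_ to _∈ₚ_)
import Data.List.Membership.Propositional.Properties as Propₚ
import Data.List.Membership.Setoid as SetoidMembership
import Data.List.Membership.Setoid.Properties as Membershipₚ
open import Data.List.Properties using (filter-all; length-map; length-take; length-tabulate; length-++)
open import Data.List.Relation.Unary.All as All using ([]; _∷_)
open import Data.List.Relation.Unary.AllPairs as AllPairs using (AllPairs; []; _∷_)
import Data.List.Relation.Unary.AllPairs.Properties as AllPairsₚ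
open import Data.List.Relation.Unary.Any as Any using (here; there)
import Data.List.Relation.Unary.Unique.DecSetoid.Properties as UniqueDecₚ
import Data.List.Relation.Unary.Unique.Setoid as UniqueSetoid
import Data.List.Relation.Unary.Unique.Setoid.Properties as Uniqueₚ
open import Data.Nat as ℕ using (ℕ; zero; suc; z≤n; s≤s; _≥_)
import Data.Nat.DivMod as ℕ
import Data.Nat.Properties as ℕ
open import Data.Product using (Σ-syntax; ∃-syntax; _×_; _,_; proj₁; proj₂)
open import Data.Product.Relation.Binary.Pointwise.NonDependent using (_×ₛ_)
open import Data.Sum using (_⊎_; inj₁; inj₂)
open import Data.Unit using (tt)
open import Data.Vec as Vec using (Vec; []; _∷_)
open import Function using (_∘_; id)
open import Function.Bundles using (_⇔_; mk⇔; Equivalence)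
open import Level using (_⊔_)
open import Relation.Binary.Bundles using (Setoid; DecSetoid)
open import Relation.Binary.Definitions using () renaming (Decidable to Decidable₂)
open import Relation.Binary.PropositionalEquality as ≡ using (_≡_)
import Relation.Binary.Reasoning.Setoid as SetoidReasoning
open import Relation.Nullary using (¬_; Dec; yes; no; contradiction; ¬?)
open import Relation.Nullary.Decidable using (decidable-stable)
import Relation.Unary as U
open import Relation.Unary using (Pred; _≐_)

-- Counting in finite sets

-- Closing up under sums and products costs a larger exponent, so no set `Stab e` is closed for
-- free. The circle breaks because the exponent 712 reached by conjugation depends on how X and b
-- were chosen, not on the exponent one starts from: 1444 can be fixed afterwards, just large enough
-- for a difference or a product of two elements of `Stab 712`. Conjugation enters because only b⁻¹h
-- and d⁻¹b are known to nearly stabilise G, and their product is b⁻¹rb, not r. The price is that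
-- the pigeonhole at exponent 1444 needs more than κ^1444 elements of X with pairwise invertible
-- differences. In a product of division rings a difference fails to be invertible only if some
-- coordinate of it vanishes, and the elements of A with a prescribed j-th coordinate number at most
-- |A+A|/|π_j(A)|. If every |π_j(A)| is at least k κ^1453, a given element has a non-invertible
-- difference with at most |A|/κ^1452 elements of A, and a greedy choice inside X succeeds.

module Finite (em : ∀ {a} → ExcludedMiddle a) where

  module _ {a p} {A : Set a} (P : A → Set p) where

    decide : U.Decidable P
    decide x = em

    select reject : List A → List A
    select = filter decide
    reject = filter (¬? ∘ decide)

    length-select+reject : ∀ xs → length xs ≡ length (select xs) ℕ.+ length (reject xs)
    length-select+reject [] = ≡.refl
    length-select+reject (x ∷ xs) with decide x
    ... | yes _ = ≡.cong suc (length-select+reject xs)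
    ... | no  _ = ≡.trans (≡.cong suc (length-select+reject xs)) (≡.sym (ℕ.+-suc _ _))

  length-filter-filter : ∀ {a p q} {A : Set a} {P : A → Set p} {Q : A → Set q}
    (P? : U.Decidable P) (Q? : U.Decidable Q) xs →
    length (filter Q? (filter P? xs)) ℕ.≤ length (filter Q? xs)
  length-filter-filter P? Q? [] = z≤n
  length-filter-filter P? Q? (x ∷ xs) with P? x
  ... | yes _ with Q? x
  ...   | yes _ = s≤s (length-filter-filter P? Q? xs)
  ...   | no  _ = length-filter-filter P? Q? xs
  length-filter-filter P? Q? (x ∷ xs) | no _ with Q? x
  ...   | yes _ = ℕ.m≤n⇒m≤1+n (length-filter-filter P? Q? xs)
  ...   | no  _ = length-filter-filter P? Q? xs

  first : ∀ {a} {A : Set a} {xs : List A} → 0 ℕ.< length xs → ∃[ x ] x ∈ₚ xs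
  first {xs = x ∷ _} _ = x , here ≡.refl

  ∈-take⁻ : ∀ {a} {A : Set a} n (xs : List A) {x} → x ∈ₚ take n xs → x ∈ₚ xs
  ∈-take⁻ (suc n) (_ ∷ xs) (here e) = here e
  ∈-take⁻ (suc n) (_ ∷ xs) (there x∈) = there (∈-take⁻ n xs x∈)

  module _ {a b r} {A : Set a} {B : Set b} (ρ : A → B → Set r) where

    fibre : B → List A → List A
    fibre l = select (λ x → ρ x l)

    -- Induction on the labels: once the fibre of the first label is removed, every remaining point
    -- has a label in the tail.
    pigeonhole-≤ : ∀ m xs ls → (∀ {x} → x ∈ₚ xs → ∃[ l ] l ∈ₚ ls × ρ x l) →
      (∀ {l} → l ∈ₚ ls → length (fibre l xs) ℕ.≤ m) → length xs ℕ.≤ length ls ℕ.* m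
    pigeonhole-≤ m [] ls f b = z≤n
    pigeonhole-≤ m (x ∷ xs) [] f b with f (here ≡.refl)
    ... | _ , () , _
    pigeonhole-≤ m xs@(_ ∷ _) (l ∷ ls) f b = begin
      length xs                                     ≡⟨ length-select+reject Q xs ⟩
      length (fibre l xs) ℕ.+ length (reject Q xs)  ≤⟨ ℕ.+-mono-≤ (b (here ≡.refl))
                                                        (pigeonhole-≤ m (reject Q xs) ls g c) ⟩
      m ℕ.+ length ls ℕ.* m                         ∎
      where
      open ℕ.≤-Reasoning
      Q = λ x → ρ x l
      g : ∀ {x} → x ∈ₚ reject Q xs → ∃[ l ] l ∈ₚ ls × ρ x l
      g x∈ with Propₚ.∈-filter⁻ (¬? ∘ decide Q) {xs = xs} x∈
      ... | x∈xs , ¬ρ with f x∈xs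
      ...   | _ , here ≡.refl , r = contradiction r ¬ρ
      ...   | l′ , there l′∈ , r = l′ , l′∈ , r
      c : ∀ {l′} → l′ ∈ₚ ls → length (fibre l′ (reject Q xs)) ℕ.≤ m
      c {l′} l′∈ = ℕ.≤-trans (length-filter-filter (¬? ∘ decide Q) (decide (λ x → ρ x l′)) xs) (b (there l′∈))

  argmax : ∀ {b} {B : Set b} (f : B → ℕ) {l₀} ls → l₀ ∈ₚ ls →
    ∃[ l ] l ∈ₚ ls × (∀ {l′} → l′ ∈ₚ ls → f l′ ℕ.≤ f l)
  argmax f (l ∷ []) _ = l , here ≡.refl , λ { (here ≡.refl) → ℕ.≤-refl }
  argmax f (l ∷ ls@(_ ∷ _)) _ with argmax f ls (here ≡.refl)
  ... | m , m∈ , max with ℕ.≤-total (f l) (f m)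
  ...   | inj₁ l≤m = m , there m∈ , λ { (here ≡.refl) → l≤m ; (there q) → max q }
  ...   | inj₂ m≤l = l , here ≡.refl , λ { (here ≡.refl) → ℕ.≤-refl ; (there q) → ℕ.≤-trans (max q) m≤l }

  -- A largest fibre is at least as large as the average one. The member `x₀` guarantees that there
  -- is a label at all.
  pigeonhole : ∀ {a b r} {A : Set a} {B : Set b} (ρ : A → B → Set r) {x₀} xs ls → x₀ ∈ₚ xs →
    (∀ {x} → x ∈ₚ xs → ∃[ l ] l ∈ₚ ls × ρ x l) →
    ∃[ l ] l ∈ₚ ls × length xs ℕ.≤ length ls ℕ.* length (fibre ρ l xs)
  pigeonhole ρ xs ls x₀∈ f with argmax (λ l → length (fibre ρ l xs)) ls (proj₁ (proj₂ (f x₀∈)))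
  ... | l , l∈ , max = l , l∈ , pigeonhole-≤ ρ _ xs ls f max

  -- A largest fibre has two entries, since otherwise there would be at least as many labels as
  -- points. Distinctness of the two is carried by a pairwise relation `Q`, which passes to sublists
  -- and can express more than inequality.
  collision : ∀ {a b r q} {A : Set a} {B : Set b} (ρ : A → B → Set r) {Q : A → A → Set q} xs ls →
    AllPairs Q xs → (∀ {x} → x ∈ₚ xs → ∃[ l ] l ∈ₚ ls × ρ x l) → length ls ℕ.< length xs →
    ∃[ x ] ∃[ y ] ∃[ l ] x ∈ₚ xs × y ∈ₚ xs × Q x y × ρ x l × ρ y l
  collision ρ {Q} xs@(_ ∷ _) ls pairs f ls<xs with pigeonhole ρ xs ls (here ≡.refl) f
  ... | l , _ , le with fibre ρ l xs in eq
  ...   | [] = contradiction (ℕ.≤-trans le (ℕ.≤-reflexive (ℕ.*-zeroʳ (length ls)))) λ ()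
  ...   | _ ∷ [] = contradiction (ℕ.≤-trans ls<xs (ℕ.≤-trans le (ℕ.≤-reflexive (ℕ.*-identityʳ (length ls))))) (ℕ.<-irrefl ≡.refl)
  ...   | x ∷ y ∷ _ with ≡.subst (AllPairs Q) eq (AllPairsₚ.filter⁺ (decide (λ x → ρ x l)) pairs)
  ...     | (q ∷ _) ∷ _ = x , y , l , proj₁ (in-xs x∈) , proj₁ (in-xs y∈) , q , proj₂ (in-xs x∈) , proj₂ (in-xs y∈)
    where
    in-xs : ∀ {z} → z ∈ₚ fibre ρ l xs → z ∈ₚ xs × ρ z l
    in-xs = Propₚ.∈-filter⁻ (decide (λ x → ρ x l))
    x∈ = ≡.subst (x ∈ₚ_) (≡.sym eq) (here ≡.refl)
    y∈ = ≡.subst (y ∈ₚ_) (≡.sym eq) (there (here ≡.refl))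

  -- A maximal separated sublist is a net: an element is left out only if it is near a chosen one.
  -- New elements go to the front and stand in the first argument of `ρ`, so the two orientations
  -- agree even for a relation not known to be symmetric.
  greedy : ∀ {a r} {A : Set a} (ρ : A → A → Set r) → (∀ x → ρ x x) → ∀ xs →
    ∃[ ys ] (∀ {y} → y ∈ₚ ys → y ∈ₚ xs) × AllPairs (λ x y → ¬ ρ x y) ys
      × (∀ {x} → x ∈ₚ xs → ∃[ y ] y ∈ₚ ys × ρ x y)
  greedy ρ ρ-refl [] = [] , id , [] , λ ()
  greedy ρ ρ-refl (x ∷ xs) with greedy ρ ρ-refl xs
  ... | ys , sub , pairs , cov with em {P = ∃[ y ] y ∈ₚ ys × ρ x y}
  ...   | yes near = ys , there ∘ sub , pairs , λ { (here ≡.refl) → near ; (there q) → cov q }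
  ...   | no far = x ∷ ys
                 , (λ { (here e) → here e ; (there q) → there (sub q) })
                 , All.tabulate (λ y∈ r → far (_ , y∈ , r)) ∷ pairs
                 , λ { (here ≡.refl) → x , here ≡.refl , ρ-refl x
                     ; (there q) → let (y , y∈ , r) = cov q in y , there y∈ , r }

  module OnSetoid {c ℓ} (S : Setoid c ℓ) where

    open Setoid S renaming (Carrier to X)
    open SetoidMembership S public using (_∈_)
    open UniqueSetoid S public using (Unique)

    infix 4 _⊆_
    _⊆_ : List X → List X → Set _
    xs ⊆ ys = ∀ {x} → x ∈ xs → x ∈ ys

    decSetoid : DecSetoid c ℓ
    decSetoid = record { isDecEquivalence = record { isEquivalence = isEquivalence ; _≟_ = λ _ _ → em } }

    infix 4 _≟_
    _≟_ : Decidable₂ _≈_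
    _ ≟ _ = em

    dedup : List X → List X
    dedup = deduplicate _≟_

    -- Sumsets and product sets are lists with repetitions, so their cardinality is counted up to
    -- `_≈_`; plain `length` serves for `Unique` lists and for lists of translates.
    ∥_∥ : List X → ℕ
    ∥ xs ∥ = length (dedup xs)

    dedup-unique : ∀ xs → Unique (dedup xs)
    dedup-unique = UniqueDecₚ.deduplicate-! decSetoid

    ∈-resp : ∀ {xs x y} → x ≈ y → x ∈ xs → y ∈ xs
    ∈-resp = Membershipₚ.∈-resp-≈ S

    ∈ₚ⇒∈ : ∀ {x xs} → x ∈ₚ xs → x ∈ xs
    ∈ₚ⇒∈ = Any.map reflexive

    dedup⁺ : ∀ {xs} → xs ⊆ dedup xs
    dedup⁺ = Membershipₚ.∈-deduplicate⁺ S _≟_ (λ e f → trans f (sym e))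

    dedup⁻ : ∀ {xs} → dedup xs ⊆ xs
    dedup⁻ {xs} = Membershipₚ.∈-deduplicate⁻ S _≟_ xs

    ∈⇒0<length : ∀ {x xs} → x ∈ xs → 0 ℕ.< length xs
    ∈⇒0<length = Membershipₚ.∈-length S

    remove : ∀ {x} ys → x ∈ ys →
      ∃[ zs ] length ys ≡ suc (length zs) × (∀ {y} → y ∈ ys → ¬ x ≈ y → y ∈ zs)
    remove (y ∷ ys) (here e) = ys , ≡.refl , λ { (here f) n → contradiction (trans e (sym f)) n ; (there q) _ → q }
    remove (y ∷ ys) (there p) with remove ys p
    ... | zs , eq , f = y ∷ zs , ≡.cong suc eq , λ { (here e) _ → here e ; (there q) n → there (f q n) }

    length-mono : ∀ {xs ys} → Unique xs → xs ⊆ ys → length xs ℕ.≤ length ys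
    length-mono [] _ = z≤n
    length-mono {x ∷ xs} {ys} (x∉ ∷ xs!) sub with remove ys (sub (here refl))
    ... | zs , eq , f = ≡.subst (suc (length xs) ℕ.≤_) (≡.sym eq) (s≤s (length-mono xs! λ z∈ →
      f (sub (there z∈)) λ e → Membershipₚ.All[≉]⇒∉ S x∉ (∈-resp (sym e) z∈)))

    unique≤∥∥ : ∀ {xs ys} → Unique xs → xs ⊆ ys → length xs ℕ.≤ ∥ ys ∥
    unique≤∥∥ xs! sub = length-mono xs! (dedup⁺ ∘ sub)

    ∥∥-mono : ∀ {xs ys} → xs ⊆ ys → ∥ xs ∥ ℕ.≤ ∥ ys ∥
    ∥∥-mono {xs} sub = unique≤∥∥ (dedup-unique xs) (sub ∘ dedup⁻)

    ∥∥≤ : ∀ {xs ys} → xs ⊆ ys → ∥ xs ∥ ℕ.≤ length ys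
    ∥∥≤ {xs} sub = length-mono (dedup-unique xs) (sub ∘ dedup⁻)

    -- A missing element could be prepended to `xs`, giving a duplicate-free list inside `ys` that
    -- is too long. This is what turns an injection of a finite set into itself into a surjection.
    ⊇-of-length : ∀ {xs ys} → Unique xs → xs ⊆ ys → length ys ℕ.≤ length xs → ys ⊆ xs
    ⊇-of-length {xs} xs! sub le {y} y∈ with em {P = y ∈ xs}
    ... | yes p = p
    ... | no y∉ = contradiction (ℕ.≤-trans (length-mono {y ∷ xs} (Membershipₚ.∉⇒All[≉] S y∉ ∷ xs!)
                    λ { (here e) → ∈-resp (sym e) y∈ ; (there q) → sub q }) le) (ℕ.<-irrefl ≡.refl)

    select⁺ : ∀ {p} {P : X → Set p} → (∀ {x y} → x ≈ y → P x → P y) →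
      ∀ {x xs} → x ∈ xs → P x → x ∈ select P xs
    select⁺ {P = P} resp = Membershipₚ.∈-filter⁺ S (decide P) resp

    select⁻ : ∀ {p} {P : X → Set p} → (∀ {x y} → x ≈ y → P x → P y) →
      ∀ {x xs} → x ∈ select P xs → x ∈ xs × P x
    select⁻ {P = P} resp = Membershipₚ.∈-filter⁻ S (decide P) resp

    reject⁻ : ∀ {p} {P : X → Set p} → (∀ {x y} → x ≈ y → P x → P y) →
      ∀ {x xs} → x ∈ reject P xs → x ∈ xs × ¬ P x
    reject⁻ {P = P} resp = Membershipₚ.∈-filter⁻ S (¬? ∘ decide P) (λ e n p → n (resp (sym e) p))

    _∩_ : List X → List X → List X
    xs ∩ ys = select (_∈ ys) xs

    module _ {i} {I : Set i} (F : I → List X) where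

      -- Bonferroni: the i-th set loses at most m points to each of the earlier ones.
      large-union : ∀ n m Z is → (∀ {i} → i ∈ₚ is → Unique (F i) × n ℕ.≤ length (F i) × F i ⊆ Z) →
        AllPairs (λ i j → length (F i ∩ F j) ℕ.≤ m) is →
        ∃[ us ] Unique us × (∀ {u} → u ∈ us → ∃[ i ] i ∈ₚ is × u ∈ F i)
          × length is ℕ.* n ℕ.≤ length us ℕ.+ length is ℕ.* (length is ℕ.* m)
      large-union n m Z [] hyp [] = [] , [] , (λ ()) , z≤n
      large-union n m Z (i ∷ is) hyp (meets ∷ pairs) with large-union n m Z is (hyp ∘ there) pairs
      ... | us , us! , from , le = new ++ us , Uniqueₚ.++⁺ S new! us! disj , from′ , le′
        where
        Fi! = proj₁ (hyp (here ≡.refl))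
        new = reject (_∈ us) (F i)
        new! = Uniqueₚ.filter⁺ S (¬? ∘ decide (_∈ us)) Fi!
        resp : ∀ {ys x y} → x ≈ y → x ∈ ys → y ∈ ys
        resp = ∈-resp
        disj : ∀ {v} → ¬ (v ∈ new × v ∈ us)
        disj (p , q) = proj₂ (reject⁻ (resp {us}) {xs = F i} p) q
        from′ : ∀ {u} → u ∈ new ++ us → ∃[ j ] j ∈ₚ i ∷ is × u ∈ F j
        from′ u∈ with Membershipₚ.∈-++⁻ S new u∈
        ... | inj₁ p = i , here ≡.refl , proj₁ (reject⁻ (resp {us}) {xs = F i} p)
        ... | inj₂ q = let (j , j∈ , r) = from q in j , there j∈ , r
        hit : ∀ {z} → z ∈ₚ F i ∩ us → ∃[ j ] j ∈ₚ is × z ∈ F j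
        hit z∈ = from (proj₂ (Propₚ.∈-filter⁻ (decide (_∈ us)) {xs = F i} z∈))
        lost : length (F i ∩ us) ℕ.≤ length is ℕ.* m
        lost = pigeonhole-≤ (λ z j → z ∈ F j) m (F i ∩ us) is hit λ j∈ →
          ℕ.≤-trans (length-filter-filter (decide (_∈ us)) (decide (λ z → z ∈ F _)) (F i)) (All.lookup meets j∈)
        open ℕ.≤-Reasoning
        t = length is
        le′ : n ℕ.+ t ℕ.* n ℕ.≤ length (new ++ us) ℕ.+ suc t ℕ.* (suc t ℕ.* m)
        le′ = begin
          n ℕ.+ t ℕ.* n
            ≤⟨ ℕ.+-mono-≤ (proj₁ (proj₂ (hyp (here ≡.refl)))) le ⟩
          length (F i) ℕ.+ (length us ℕ.+ t ℕ.* (t ℕ.* m))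
            ≡⟨ ≡.cong (ℕ._+ (length us ℕ.+ t ℕ.* (t ℕ.* m))) (length-select+reject (_∈ us) (F i)) ⟩
          (length (F i ∩ us) ℕ.+ length new) ℕ.+ (length us ℕ.+ t ℕ.* (t ℕ.* m))
            ≤⟨ ℕ.+-monoˡ-≤ _ (ℕ.+-monoˡ-≤ _ lost) ⟩
          (t ℕ.* m ℕ.+ length new) ℕ.+ (length us ℕ.+ t ℕ.* (t ℕ.* m))
            ≡⟨ rearrange (t ℕ.* m) (length new) (length us) (t ℕ.* (t ℕ.* m)) ⟩
          (length new ℕ.+ length us) ℕ.+ (t ℕ.* m ℕ.+ t ℕ.* (t ℕ.* m))
            ≡⟨ ≡.cong (ℕ._+ (t ℕ.* m ℕ.+ t ℕ.* (t ℕ.* m))) (length-++ new) ⟨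
          length (new ++ us) ℕ.+ suc t ℕ.* (t ℕ.* m)
            ≤⟨ ℕ.+-monoʳ-≤ (length (new ++ us)) (ℕ.*-monoʳ-≤ (suc t) (ℕ.m≤n+m (t ℕ.* m) m)) ⟩
          length (new ++ us) ℕ.+ suc t ℕ.* (suc t ℕ.* m) ∎
          where
          open CommutativeSemigroupₚ ℕ.+-commutativeSemigroup using (interchange)
          rearrange : ∀ a b c d → (a ℕ.+ b) ℕ.+ (c ℕ.+ d) ≡ (b ℕ.+ c) ℕ.+ (a ℕ.+ d)
          rearrange a b c d = ≡.trans (≡.cong (ℕ._+ (c ℕ.+ d)) (ℕ.+-comm a b)) (interchange b a c d)

      almost-disjoint : ∀ n m Z is → (∀ {i} → i ∈ₚ is → Unique (F i) × n ℕ.≤ length (F i) × F i ⊆ Z) →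
        AllPairs (λ i j → length (F i ∩ F j) ℕ.≤ m) is →
        length is ℕ.* n ℕ.≤ ∥ Z ∥ ℕ.+ length is ℕ.* (length is ℕ.* m)
      almost-disjoint n m Z is hyp pairs with large-union n m Z is hyp pairs
      ... | us , us! , from , le = ℕ.≤-trans le (ℕ.+-monoˡ-≤ _ (unique≤∥∥ us! λ u∈ →
        let (i , i∈ , q) = from u∈ in proj₂ (proj₂ (hyp i∈)) q))

      -- The case of overlap 0 in the Bonferroni bound.
      packing : ∀ n Z is → (∀ {i} → i ∈ₚ is → Unique (F i) × n ℕ.≤ length (F i) × F i ⊆ Z) →
        AllPairs (λ i j → ∀ z → z ∈ F i → ¬ z ∈ F j) is → length is ℕ.* n ℕ.≤ ∥ Z ∥
      packing n Z is hyp pairs = ≡.subst (length is ℕ.* n ℕ.≤_)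
        (≡.trans (≡.cong (∥ Z ∥ ℕ.+_) (≡.trans (≡.cong (length is ℕ.*_) (ℕ.*-zeroʳ (length is))) (ℕ.*-zeroʳ (length is))))
          (ℕ.+-identityʳ _))
        (almost-disjoint n 0 Z is hyp (AllPairs.map (λ {i} {j} → empty i j) pairs))
        where
        empty : ∀ i j → (∀ z → z ∈ F i → ¬ z ∈ F j) → length (F i ∩ F j) ℕ.≤ 0
        empty i j d with F i ∩ F j in eq
        ... | [] = z≤n
        ... | z ∷ _ with Propₚ.∈-filter⁻ (decide (_∈ F j)) {xs = F i} (≡.subst (z ∈ₚ_) (≡.sym eq) (here ≡.refl))
        ...   | p , q = contradiction q (d z (∈ₚ⇒∈ p))

      -- Ruzsa covering, for an arbitrary relation implied by F i meeting F j.
      covering : ∀ {r} (ρ : I → I → Set r) → (∀ i → ρ i i) → (∀ {i j z} → z ∈ F i → z ∈ F j → ρ i j) →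
        ∀ n Z is → (∀ {i} → i ∈ₚ is → Unique (F i) × n ℕ.≤ length (F i) × F i ⊆ Z) →
        ∃[ ys ] (∀ {y} → y ∈ₚ ys → y ∈ₚ is) × length ys ℕ.* n ℕ.≤ ∥ Z ∥
          × (∀ {i} → i ∈ₚ is → ∃[ y ] y ∈ₚ ys × ρ i y)
      covering ρ ρ-refl meet n Z is hyp with greedy ρ ρ-refl is
      ... | ys , sub , pairs , cov = ys , sub
        , packing n Z ys (hyp ∘ sub) (AllPairs.map (λ ¬ρ z p q → ¬ρ (meet p q)) pairs) , cov

-- Sumsets in abelian groups

length-cartesianProductWith : ∀ {a b c} {A : Set a} {B : Set b} {C : Set c} (f : A → B → C) xs ys →
  length (cartesianProductWith f xs ys) ≡ length xs ℕ.* length ys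
length-cartesianProductWith f [] ys = ≡.refl
length-cartesianProductWith f (x ∷ xs) ys = ≡.trans (length-++ (map (f x) ys))
  (≡.cong₂ ℕ._+_ (length-map (f x) ys) (length-cartesianProductWith f xs ys))

-- Deciding identities in abelian groups

module AbelianGroupSolver {c ℓ} (G : AbelianGroup c ℓ) where

  open AbelianGroup G
  open CommutativeSemigroupₚ commutativeSemigroup using (interchange)
  module M = CommutativeMonoidSolver commutativeMonoid
  open CommutativeMonoidNormal commutativeMonoid using (correct)

  infixl 6 _⊕_ _⊖_

  data Expr (n : ℕ) : Set where
    var     : Fin n → Expr n
    _⊕_ _⊖_ : Expr n → Expr n → Expr n

  ⟦_⟧ : ∀ {n} → Expr n → Vec Carrier n → Carrier
  ⟦ var i ⟧ ρ = Vec.lookup ρ i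
  ⟦ d ⊕ e ⟧ ρ = ⟦ d ⟧ ρ ∙ ⟦ e ⟧ ρ
  ⟦ d ⊖ e ⟧ ρ = ⟦ d ⟧ ρ - ⟦ e ⟧ ρ

  positive negative : ∀ {n} → Expr n → M.Expr n
  positive (var i) = M.var i
  positive (d ⊕ e) = positive d M.⊕ positive e
  positive (d ⊖ e) = positive d M.⊕ negative e
  negative (var i) = M.id
  negative (d ⊕ e) = negative d M.⊕ negative e
  negative (d ⊖ e) = negative d M.⊕ positive e

  open SetoidReasoning setoid

  split : ∀ {n} (e : Expr n) ρ → ⟦ e ⟧ ρ ∙ M.⟦ negative e ⟧ ρ ≈ M.⟦ positive e ⟧ ρ
  split (var i) ρ = identityʳ _
  split (d ⊕ e) ρ = trans (interchange _ _ _ _) (∙-cong (split d ρ) (split e ρ))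
  split (d ⊖ e) ρ = begin
    (x - y) ∙ (d⁻ ∙ e⁺)        ≈⟨ interchange _ _ _ _ ⟩
    (x ∙ d⁻) ∙ (y ⁻¹ ∙ e⁺)     ≈⟨ ∙-cong (split d ρ) (∙-congˡ (sym (split e ρ))) ⟩
    d⁺ ∙ (y ⁻¹ ∙ (y ∙ e⁻))     ≈⟨ ∙-congˡ (assoc _ _ _) ⟨
    d⁺ ∙ ((y ⁻¹ ∙ y) ∙ e⁻)     ≈⟨ ∙-congˡ (∙-congʳ (inverseˡ y)) ⟩
    d⁺ ∙ (ε ∙ e⁻)              ≈⟨ ∙-congˡ (identityˡ _) ⟩
    d⁺ ∙ e⁻                    ∎
    where
    x = ⟦ d ⟧ ρ
    y = ⟦ e ⟧ ρ
    d⁺ = M.⟦ positive d ⟧ ρ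
    d⁻ = M.⟦ negative d ⟧ ρ
    e⁺ = M.⟦ positive e ⟧ ρ
    e⁻ = M.⟦ negative e ⟧ ρ

  -- Moving every subtracted term to the other side leaves an identity of commutative monoids, which
  -- is checked by comparing normal forms; hence the `≡.refl` at each use.
  solveₐ : ∀ {n} (d e : Expr n) →
    M.normalise (positive d M.⊕ negative e) ≡ M.normalise (positive e M.⊕ negative d) →
    ∀ ρ → ⟦ d ⟧ ρ ≈ ⟦ e ⟧ ρ
  solveₐ d e eq ρ = ∙-cancelʳ (d⁻ ∙ e⁻) x y (begin
    x ∙ (d⁻ ∙ e⁻)   ≈⟨ assoc _ _ _ ⟨
    (x ∙ d⁻) ∙ e⁻   ≈⟨ ∙-congʳ (split d ρ) ⟩
    d⁺ ∙ e⁻         ≈⟨ correct (positive d M.⊕ negative e) ρ ⟨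
    M.⟦ M.normalise (positive d M.⊕ negative e) ⟧⇓ ρ ≡⟨ ≡.cong (λ z → M.⟦ z ⟧⇓ ρ) eq ⟩
    M.⟦ M.normalise (positive e M.⊕ negative d) ⟧⇓ ρ ≈⟨ correct (positive e M.⊕ negative d) ρ ⟩
    e⁺ ∙ d⁻         ≈⟨ ∙-congʳ (split e ρ) ⟨
    (y ∙ e⁻) ∙ d⁻   ≈⟨ assoc _ _ _ ⟩
    y ∙ (e⁻ ∙ d⁻)   ≈⟨ ∙-congˡ (comm _ _) ⟩
    y ∙ (d⁻ ∙ e⁻)   ∎)
    where
    open AbelianGroupₚ G using (∙-cancelʳ)
    x = ⟦ d ⟧ ρ
    y = ⟦ e ⟧ ρ
    d⁺ = M.⟦ positive d ⟧ ρ
    d⁻ = M.⟦ negative d ⟧ ρ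
    e⁺ = M.⟦ positive e ⟧ ρ
    e⁻ = M.⟦ negative e ⟧ ρ

module Sumsets (em : ∀ {a} → ExcludedMiddle a) {c ℓ} (G : AbelianGroup c ℓ) where

  open AbelianGroup G renaming (_∙_ to infixl 6 _+_; ∙-cong to +-cong; ∙-congˡ to +-congˡ; ∙-congʳ to +-congʳ; _⁻¹ to -_; ⁻¹-cong to -‿cong)
  open AbelianGroupSolver G
  open AbelianGroupₚ G using (∙-cancelʳ; ∙-cancelˡ)
  open Finite em
  open OnSetoid setoid

  -‿cong₂ : ∀ {a b c d} → a ≈ b → c ≈ d → a - c ≈ b - d
  -‿cong₂ p q = +-cong p (-‿cong q)

  v₀ : ∀ {n} → Expr (1 ℕ.+ n)
  v₀ = var zero
  v₁ : ∀ {n} → Expr (2 ℕ.+ n)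
  v₁ = var (# 1)
  v₂ : ∀ {n} → Expr (3 ℕ.+ n)
  v₂ = var (# 2)
  v₃ : ∀ {n} → Expr (4 ℕ.+ n)
  v₃ = var (# 3)
  v₄ : ∀ {n} → Expr (5 ℕ.+ n)
  v₄ = var (# 4)

  infixl 6 _⊞_ _⊟_

  _⊞_ _⊟_ : List Carrier → List Carrier → List Carrier
  _⊞_ = cartesianProductWith _+_
  _⊟_ = cartesianProductWith _-_

  ⊞⁺ : ∀ {U V u v} → u ∈ U → v ∈ V → u + v ∈ U ⊞ V
  ⊞⁺ = Membershipₚ.∈-cartesianProductWith⁺ setoid setoid setoid +-cong

  ⊞⁻ : ∀ U V {z} → z ∈ U ⊞ V → ∃[ u ] ∃[ v ] u ∈ U × v ∈ V × z ≈ u + v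
  ⊞⁻ = Membershipₚ.∈-cartesianProductWith⁻ setoid setoid setoid _+_

  ⊟⁺ : ∀ {U V u v} → u ∈ U → v ∈ V → u - v ∈ U ⊟ V
  ⊟⁺ = Membershipₚ.∈-cartesianProductWith⁺ setoid setoid setoid -‿cong₂

  ⊟⁻ : ∀ U V {z} → z ∈ U ⊟ V → ∃[ u ] ∃[ v ] u ∈ U × v ∈ V × z ≈ u - v
  ⊟⁻ = Membershipₚ.∈-cartesianProductWith⁻ setoid setoid setoid _-_

  ⊞-mono : ∀ {U U′ V V′} → U ⊆ U′ → V ⊆ V′ → U ⊞ V ⊆ U′ ⊞ V′
  ⊞-mono {U} {U′} {V} p q z∈ with ⊞⁻ U V z∈
  ... | u , v , u∈ , v∈ , e = ∈-resp (sym e) (⊞⁺ (p u∈) (q v∈))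

  ⊟-mono : ∀ {U U′ V V′} → U ⊆ U′ → V ⊆ V′ → U ⊟ V ⊆ U′ ⊟ V′
  ⊟-mono {U} {U′} {V} p q z∈ with ⊟⁻ U V z∈
  ... | u , v , u∈ , v∈ , e = ∈-resp (sym e) (⊟⁺ (p u∈) (q v∈))

  translate-unique : ∀ {V} u → Unique V → Unique (map (u +_) V)
  translate-unique u = Uniqueₚ.map⁺ setoid setoid (∙-cancelˡ u _ _)

  translate⁻ : ∀ {V} u {z} → z ∈ map (u +_) V → ∃[ v ] v ∈ V × z ≈ u + v
  translate⁻ u = Membershipₚ.∈-map⁻ setoid setoid

  translate-⊆ : ∀ {U V u} → u ∈ U → map (u +_) V ⊆ U ⊞ V
  translate-⊆ u∈ z∈ with translate⁻ _ z∈
  ... | v , v∈ , e = ∈-resp (sym e) (⊞⁺ u∈ v∈)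

  length≤∥⊞∥ : ∀ {u U V} → u ∈ U → Unique V → length V ℕ.≤ ∥ U ⊞ V ∥
  length≤∥⊞∥ {u} {V = V} u∈ V! = ≡.subst (ℕ._≤ _) (length-map (u +_) V)
    (unique≤∥∥ (translate-unique u V!) (translate-⊆ u∈))

  -- Ruzsa's covering lemma: the translates u + P lie in U + P, so at most |U+P|/|P| of them are
  -- disjoint, and if u + P meets y + P then u lies in (P - P) + y.
  ruzsa-covering : ∀ {p₀ P} U → Unique P → p₀ ∈ P →
    ∃[ Y ] length Y ℕ.* length P ℕ.≤ ∥ U ⊞ P ∥ × U ⊆ (P ⊟ P) ⊞ Y
  ruzsa-covering {p₀} {P} U P! p₀∈ =
    let (Y , _ , le , cov) = covering (λ u → map (u +_) P) ρ ρ-refl meet (length P) (U ⊞ P) U λ {u} u∈ →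
          translate-unique u P! , ℕ.≤-reflexive (≡.sym (length-map (u +_) P)) , translate-⊆ (∈ₚ⇒∈ u∈)
    in Y , le , λ u∈ → let (u′ , u′∈ , e) = find u∈
                           (y , y∈ , p , p′ , p∈ , p′∈ , f) = cov u′∈
                       in ∈-resp (sym (trans e f)) (⊞⁺ (⊟⁺ p∈ p′∈) (∈ₚ⇒∈ y∈))
    where
    ρ : Carrier → Carrier → Set _
    ρ u y = ∃[ p ] ∃[ p′ ] p ∈ P × p′ ∈ P × u ≈ (p - p′) + y
    ρ-refl : ∀ u → ρ u u
    ρ-refl u = p₀ , p₀ , p₀∈ , p₀∈ , solveₐ v₀ (v₁ ⊖ v₁ ⊕ v₀) ≡.refl (u ∷ p₀ ∷ [])
    meet : ∀ {u y z} → z ∈ map (u +_) P → z ∈ map (y +_) P → ρ u y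
    meet {u} {y} {z} p q with translate⁻ u p | translate⁻ y q
    ... | a , a∈ , e | b , b∈ , f = b , a , b∈ , a∈ , (begin
      u             ≈⟨ solveₐ v₀ (v₀ ⊕ v₁ ⊖ v₁) ≡.refl (u ∷ a ∷ []) ⟩
      u + a - a     ≈⟨ +-congʳ (trans (sym e) f) ⟩
      y + b - a     ≈⟨ solveₐ (v₀ ⊕ v₁ ⊖ v₂) (v₁ ⊖ v₂ ⊕ v₀) ≡.refl (y ∷ b ∷ a ∷ []) ⟩
      b - a + y     ∎)
      where open SetoidReasoning setoid

  -- A pair (u, w) yields |V| points (u + v, w + v) of (U+V) × (W+V), and u - w can be read off from
  -- each of them. So the point sets belonging to different values of u - w are disjoint.
  ruzsa-triangle : ∀ U W {V} → Unique V → ∥ U ⊟ W ∥ ℕ.* length V ℕ.≤ ∥ U ⊞ V ∥ ℕ.* ∥ W ⊞ V ∥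
  ruzsa-triangle U W {V} V! = go (S².covering F ρ (λ _ → refl) (λ {i} {j} → meet {i} {j}) (length V) Z (cartesianProduct U W) hyp)
    where
    S² = setoid ×ₛ setoid
    module S² = OnSetoid S²
    F : Carrier × Carrier → List (Carrier × Carrier)
    F (u , w) = map (λ v → u + v , w + v) V
    Z = cartesianProduct (dedup (U ⊞ V)) (dedup (W ⊞ V))
    ρ : Carrier × Carrier → Carrier × Carrier → Set ℓ
    ρ (u , w) (u′ , w′) = u - w ≈ u′ - w′
    F⁻ : ∀ {u w z} → z S².∈ F (u , w) → ∃[ v ] v ∈ V × proj₁ z ≈ u + v × proj₂ z ≈ w + v
    F⁻ z∈ with Membershipₚ.∈-map⁻ setoid S² z∈
    ... | v , v∈ , e , f = v , v∈ , e , f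
    meet : ∀ {i j z} → z S².∈ F i → z S².∈ F j → ρ i j
    meet {u , w} {u′ , w′} {z₁ , z₂} p q with F⁻ p | F⁻ q
    ... | v , _ , e , f | v′ , _ , e′ , f′ = begin
      u - w                    ≈⟨ solveₐ (v₀ ⊖ v₁) (v₀ ⊕ v₂ ⊖ (v₁ ⊕ v₂)) ≡.refl (u ∷ w ∷ v ∷ []) ⟩
      u + v - (w + v)          ≈⟨ -‿cong₂ (trans (sym e) e′) (trans (sym f) f′) ⟩
      u′ + v′ - (w′ + v′)      ≈⟨ solveₐ (v₀ ⊖ v₁) (v₀ ⊕ v₂ ⊖ (v₁ ⊕ v₂)) ≡.refl (u′ ∷ w′ ∷ v′ ∷ []) ⟨
      u′ - w′                  ∎
      where open SetoidReasoning setoid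
    hyp : ∀ {i} → i ∈ₚ cartesianProduct U W → S².Unique (F i) × length V ℕ.≤ length (F i) × F i S².⊆ Z
    hyp {u , w} i∈ with Propₚ.∈-cartesianProduct⁻ U W i∈
    ... | u∈ , w∈ = Uniqueₚ.map⁺ setoid S² (λ (e , _) → ∙-cancelˡ u _ _ e) V!
      , ℕ.≤-reflexive (≡.sym (length-map _ V))
      , λ {z} z∈ → let (v , v∈ , e , f) = F⁻ z∈ in S².∈-resp {Z} (sym e , sym f)
          (Membershipₚ.∈-cartesianProduct⁺ setoid setoid (dedup⁺ (⊞⁺ (∈ₚ⇒∈ u∈) v∈)) (dedup⁺ (⊞⁺ (∈ₚ⇒∈ w∈) v∈)))
    go : (∃[ Y ] (∀ {y} → y ∈ₚ Y → y ∈ₚ cartesianProduct U W) × length Y ℕ.* length V ℕ.≤ S².∥ Z ∥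
           × (∀ {i} → i ∈ₚ cartesianProduct U W → ∃[ y ] y ∈ₚ Y × ρ i y)) →
         ∥ U ⊟ W ∥ ℕ.* length V ℕ.≤ ∥ U ⊞ V ∥ ℕ.* ∥ W ⊞ V ∥
    go (Y , _ , le , cov) = begin
      ∥ U ⊟ W ∥ ℕ.* length V    ≤⟨ ℕ.*-monoˡ-≤ (length V) (∥∥≤ {ys = map diff Y} sub) ⟩
      length (map diff Y) ℕ.* length V ≡⟨ ≡.cong (ℕ._* length V) (length-map diff Y) ⟩
      length Y ℕ.* length V     ≤⟨ le ⟩
      S².∥ Z ∥                   ≤⟨ S².∥∥≤ {Z} {Z} id ⟩
      length Z                  ≡⟨ length-cartesianProductWith _,_ (dedup (U ⊞ V)) (dedup (W ⊞ V)) ⟩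
      ∥ U ⊞ V ∥ ℕ.* ∥ W ⊞ V ∥   ∎
      where
      open ℕ.≤-Reasoning
      diff : Carrier × Carrier → Carrier
      diff (u , w) = u - w
      sub : U ⊟ W ⊆ map diff Y
      sub z∈ with ⊟⁻ U W z∈
      ... | u , w , u∈ , w∈ , e with find u∈ | find w∈
      ...   | u′ , u′∈ , eᵤ | w′ , w′∈ , e_w with cov (Propₚ.∈-cartesianProduct⁺ u′∈ w′∈)
      ...     | y , y∈ , f = ∈-resp (sym (trans e (trans (-‿cong₂ eᵤ e_w) f))) (∈ₚ⇒∈ (Propₚ.∈-map⁺ diff y∈))

  -- Petridis's lemma

  module _ (B : List Carrier) where

    -- Minimality of the ratio |X+B|/|X| among the subsets of X, cross-multiplied to stay in ℕ; the
    -- empty subset satisfies it trivially.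
    IsMinimal : List Carrier → Set _
    IsMinimal X = ∀ {Z} → Unique Z → Z ⊆ X → ∥ X ⊞ B ∥ ℕ.* length Z ℕ.≤ ∥ Z ⊞ B ∥ ℕ.* length X

    -- Descent: a subset of strictly smaller ratio replaces `Y`. It is non-empty, strictly shorter
    -- and inherits the bound `k`; `n` bounds the length and makes the recursion structural.
    minimal-subset : ∀ k n Y → length Y ℕ.≤ n → Unique Y → 0 ℕ.< length Y → ∥ Y ⊞ B ∥ ℕ.≤ k ℕ.* length Y →
      ∃[ X ] X ⊆ Y × Unique X × 0 ℕ.< length X × ∥ X ⊞ B ∥ ℕ.≤ k ℕ.* length X × IsMinimal X
    minimal-subset k zero Y Y≤n Y! 0<Y bound = contradiction (ℕ.≤-trans 0<Y Y≤n) λ ()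
    minimal-subset k (suc n) Y Y≤n Y! 0<Y bound
      with em {P = ∃[ Z ] Unique Z × Z ⊆ Y × ∥ Z ⊞ B ∥ ℕ.* length Y ℕ.< ∥ Y ⊞ B ∥ ℕ.* length Z}
    ... | no none = Y , id , Y! , 0<Y , bound , λ Z! Z⊆ → ℕ.≮⇒≥ λ lt → none (_ , Z! , Z⊆ , lt)
    ... | yes (Z , Z! , Z⊆ , lt) = let (X , X⊆ , rest) = minimal-subset k n Z Z≤n Z! 0<Z bound′ in X , Z⊆ ∘ X⊆ , rest
      where
      0<Z : 0 ℕ.< length Z
      0<Z = ℕ.n≢0⇒n>0 λ eq → contradiction (ℕ.<-≤-trans lt (ℕ.≤-reflexive
        (≡.trans (≡.cong (∥ Y ⊞ B ∥ ℕ.*_) eq) (ℕ.*-zeroʳ ∥ Y ⊞ B ∥)))) λ ()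
      Z<Y : length Z ℕ.< length Y
      Z<Y = ℕ.≰⇒> λ Y≤Z → ℕ.<⇒≱ lt (ℕ.*-mono-≤
        (∥∥-mono (⊞-mono {V = B} (⊇-of-length Z! Z⊆ Y≤Z) id)) (length-mono Z! Z⊆))
      Z≤n : length Z ℕ.≤ n
      Z≤n = ℕ.≤-pred (ℕ.≤-trans Z<Y Y≤n)
      bound′ : ∥ Z ⊞ B ∥ ℕ.≤ k ℕ.* length Z
      bound′ = ℕ.*-cancelʳ-≤ ∥ Z ⊞ B ∥ (k ℕ.* length Z) (length Y) {{ℕ.>-nonZero 0<Y}} (begin
        ∥ Z ⊞ B ∥ ℕ.* length Y         ≤⟨ ℕ.<⇒≤ lt ⟩
        ∥ Y ⊞ B ∥ ℕ.* length Z         ≤⟨ ℕ.*-monoˡ-≤ (length Z) bound ⟩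
        k ℕ.* length Y ℕ.* length Z    ≡⟨ ℕ.*-assoc k (length Y) (length Z) ⟩
        k ℕ.* (length Y ℕ.* length Z)  ≡⟨ ≡.cong (k ℕ.*_) (ℕ.*-comm (length Y) (length Z)) ⟩
        k ℕ.* (length Z ℕ.* length Y)  ≡⟨ ℕ.*-assoc k (length Z) (length Y) ⟨
        k ℕ.* length Z ℕ.* length Y    ∎)
        where open ℕ.≤-Reasoning

    -- One step of Petridis's induction: adding c to C gains |X+B| − |Z+B| points in X+C+B and
    -- at least |X| − |Z| points in X+C, where Z consists of the x with x+c+B inside X+C+B.
    petridis-step : ∀ {X} → Unique X → IsMinimal X → ∀ c C →
      ∥ (X ⊞ C) ⊞ B ∥ ℕ.* length X ℕ.≤ ∥ X ⊞ B ∥ ℕ.* ∥ X ⊞ C ∥ →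
      ∥ (X ⊞ (c ∷ C)) ⊞ B ∥ ℕ.* length X ℕ.≤ ∥ X ⊞ B ∥ ℕ.* ∥ X ⊞ (c ∷ C) ∥
    -- Minimality gives p · |Z| ≤ |Z+B| · |X|; adding p · |Z| to both sides avoids subtraction.
    petridis-step {X} X! minimal c C ih = ℕ.+-cancelʳ-≤ (p ℕ.* length Z) _ _ (begin
      N ℕ.* length X ℕ.+ p ℕ.* length Z             ≤⟨ ℕ.+-monoʳ-≤ (N ℕ.* length X) (minimal Z! Z⊆X) ⟩
      N ℕ.* length X ℕ.+ ∥ Z ⊞ B ∥ ℕ.* length X     ≡⟨ ℕ.*-distribʳ-+ (length X) N ∥ Z ⊞ B ∥ ⟨
      (N ℕ.+ ∥ Z ⊞ B ∥) ℕ.* length X                ≤⟨ ℕ.*-monoˡ-≤ (length X) upper ⟩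
      (∥ old ⊞ B ∥ ℕ.+ p) ℕ.* length X              ≡⟨ ℕ.*-distribʳ-+ (length X) ∥ old ⊞ B ∥ p ⟩
      ∥ old ⊞ B ∥ ℕ.* length X ℕ.+ p ℕ.* length X   ≤⟨ ℕ.+-monoˡ-≤ (p ℕ.* length X) ih ⟩
      p ℕ.* ∥ old ∥ ℕ.+ p ℕ.* length X              ≡⟨ ℕ.*-distribˡ-+ p ∥ old ∥ (length X) ⟨
      p ℕ.* (∥ old ∥ ℕ.+ length X)                  ≤⟨ ℕ.*-monoʳ-≤ p lower ⟩
      p ℕ.* (∥ new ∥ ℕ.+ length Z)                  ≡⟨ ℕ.*-distribˡ-+ p ∥ new ∥ (length Z) ⟩
      p ℕ.* ∥ new ∥ ℕ.+ p ℕ.* length Z              ∎)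
      where
      open ℕ.≤-Reasoning
      old = X ⊞ C
      new = X ⊞ (c ∷ C)
      p = ∥ X ⊞ B ∥
      N = ∥ new ⊞ B ∥
      Full : Carrier → Set _
      Full x = ∀ {b} → b ∈ B → (x + c) + b ∈ old ⊞ B
      full-resp : ∀ {x y} → x ≈ y → Full x → Full y
      full-resp e f b∈ = ∈-resp (+-congʳ (+-congʳ e)) (f b∈)
      Z = select Full X
      Z! : Unique Z
      Z! = Uniqueₚ.filter⁺ setoid (decide Full) X!
      Z⊆X : Z ⊆ X
      Z⊆X {x} = proj₁ ∘ select⁻ {P = Full} full-resp {x} {X}
      inZ+B : Carrier → Set _
      inZ+B y = y ∈ Z ⊞ B
      fresh = reject inZ+B (dedup (X ⊞ B))
      upper : N ℕ.+ ∥ Z ⊞ B ∥ ℕ.≤ ∥ old ⊞ B ∥ ℕ.+ p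
      upper = begin
        N ℕ.+ ∥ Z ⊞ B ∥
          ≤⟨ ℕ.+-mono-≤ (∥∥≤ cover) (∥∥≤ {ys = select inZ+B (dedup (X ⊞ B))} λ z∈ →
               select⁺ {P = inZ+B} ∈-resp (dedup⁺ (⊞-mono {V = B} Z⊆X id z∈)) z∈) ⟩
        length (dedup (old ⊞ B) ++ map (_+ c) fresh) ℕ.+ s
          ≡⟨ ≡.cong (ℕ._+ s) (≡.trans (length-++ (dedup (old ⊞ B))) (≡.cong (∥ old ⊞ B ∥ ℕ.+_) (length-map (_+ c) fresh))) ⟩
        (∥ old ⊞ B ∥ ℕ.+ length fresh) ℕ.+ s
          ≡⟨ ≡.trans (ℕ.+-assoc ∥ old ⊞ B ∥ (length fresh) s) (≡.cong (∥ old ⊞ B ∥ ℕ.+_) (ℕ.+-comm (length fresh) s)) ⟩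
        ∥ old ⊞ B ∥ ℕ.+ (s ℕ.+ length fresh)
          ≡⟨ ≡.cong (∥ old ⊞ B ∥ ℕ.+_) (length-select+reject inZ+B (dedup (X ⊞ B))) ⟨
        ∥ old ⊞ B ∥ ℕ.+ p ∎
        where
        s = length (select inZ+B (dedup (X ⊞ B)))
        -- If x + b = z + b′ with z in Z, then x + c + b = (z + c) + b′ already lies in X + C + B.
        -- So c contributes only translates of points of X + B outside Z + B.
        cover : new ⊞ B ⊆ dedup (old ⊞ B) ++ map (_+ c) fresh
        cover z∈ with ⊞⁻ new B z∈
        ... | w , b , w∈ , b∈ , e with ⊞⁻ X (c ∷ C) w∈
        ...   | x , _ , x∈ , there c′∈ , f =
          Membershipₚ.∈-++⁺ˡ setoid (dedup⁺ (∈-resp (sym (trans e (+-congʳ f))) (⊞⁺ (⊞⁺ x∈ c′∈) b∈)))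
        ...   | x , c′ , x∈ , here c′≈c , f with em {P = x + b ∈ Z ⊞ B}
        ...     | no ∉ = Membershipₚ.∈-++⁺ʳ setoid (dedup (old ⊞ B)) (∈-resp (sym eq)
                    (Membershipₚ.∈-map⁺ setoid setoid (λ q → +-congʳ q)
                      (Membershipₚ.∈-filter⁺ setoid (¬? ∘ decide inZ+B) (λ q n r → n (∈-resp (sym q) r)) (dedup⁺ (⊞⁺ x∈ b∈)) ∉)))
          where
          eq = trans (trans e (+-congʳ (trans f (+-congˡ c′≈c))))
                 (solveₐ (v₀ ⊕ v₁ ⊕ v₂) (v₀ ⊕ v₂ ⊕ v₁) ≡.refl (x ∷ c ∷ b ∷ []))
        ...     | yes ∈ with ⊞⁻ Z B ∈
        ...       | z , b′ , z∈′ , b′∈ , g = Membershipₚ.∈-++⁺ˡ setoid (dedup⁺ (∈-resp (sym eq)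
                      (proj₂ (select⁻ {P = Full} full-resp {z} {X} z∈′) b′∈)))
          where
          eq = trans (trans e (+-congʳ (trans f (+-congˡ c′≈c))))
                 (trans (solveₐ (v₀ ⊕ v₁ ⊕ v₂) (v₀ ⊕ v₂ ⊕ v₁) ≡.refl (x ∷ c ∷ b ∷ []))
                   (trans (+-congʳ g) (solveₐ (v₀ ⊕ v₂ ⊕ v₁) (v₀ ⊕ v₁ ⊕ v₂) ≡.refl (z ∷ c ∷ b′ ∷ []))))
      inOld : Carrier → Set _
      inOld x = x + c ∈ old
      inOld-resp : ∀ {x y} → x ≈ y → inOld x → inOld y
      inOld-resp e = ∈-resp (+-congʳ e)
      extra = reject inOld X
      extra⁻ : ∀ {z} → z ∈ map (_+ c) extra → ∃[ x ] x ∈ X × ¬ inOld x × z ≈ x + c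
      extra⁻ z∈ with Membershipₚ.∈-map⁻ setoid setoid z∈
      ... | x , x∈ , e = let (p , q) = reject⁻ {P = inOld} inOld-resp {x} {X} x∈ in x , p , q , e
      lower : ∥ old ∥ ℕ.+ length X ℕ.≤ ∥ new ∥ ℕ.+ length Z
      lower = begin
        ∥ old ∥ ℕ.+ length X
          ≡⟨ ≡.cong (∥ old ∥ ℕ.+_) (≡.trans (length-select+reject inOld X) (ℕ.+-comm (length (select inOld X)) (length extra))) ⟩
        ∥ old ∥ ℕ.+ (length extra ℕ.+ length (select inOld X))
          ≡⟨ ℕ.+-assoc ∥ old ∥ (length extra) _ ⟨
        ∥ old ∥ ℕ.+ length extra ℕ.+ length (select inOld X)
          ≡⟨ ≡.cong (ℕ._+ length (select inOld X)) (≡.trans (length-++ (dedup old)) (≡.cong (∥ old ∥ ℕ.+_) (length-map (_+ c) extra))) ⟨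
        length (dedup old ++ map (_+ c) extra) ℕ.+ length (select inOld X)
          ≤⟨ ℕ.+-mono-≤ (unique≤∥∥ (Uniqueₚ.++⁺ setoid (dedup-unique old)
               (Uniqueₚ.map⁺ setoid setoid (∙-cancelʳ c _ _) (Uniqueₚ.filter⁺ setoid (¬? ∘ decide inOld) X!)) disj) sub)
               (length-mono (Uniqueₚ.filter⁺ setoid (decide inOld) X!) old⇒Z) ⟩
        ∥ new ∥ ℕ.+ length Z ∎
        where
        disj : ∀ {z} → ¬ (z ∈ dedup old × z ∈ map (_+ c) extra)
        disj (p , q) with extra⁻ q
        ... | x , _ , n , e = n (∈-resp e (dedup⁻ p))
        sub : dedup old ++ map (_+ c) extra ⊆ new
        sub z∈ with Membershipₚ.∈-++⁻ setoid (dedup old) z∈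
        ... | inj₁ p = ⊞-mono {X} {V = C} id there (dedup⁻ p)
        ... | inj₂ q with extra⁻ q
        ...   | x , x∈ , _ , e = ∈-resp (sym e) (⊞⁺ x∈ (here refl))
        -- Once x + c lies in X + C, all of x + c + B lies in X + C + B.
        old⇒Z : select inOld X ⊆ Z
        old⇒Z {x} x∈ with select⁻ {P = inOld} inOld-resp {x} {X} x∈
        ... | x∈X , o = select⁺ {P = Full} full-resp x∈X (⊞⁺ o)

    -- One subset of minimal ratio serves all `C` simultaneously. The induction adds the elements of
    -- `C` one at a time, starting from the empty list, where X + C + B is empty.
    petridis : ∀ k Y → Unique Y → 0 ℕ.< length Y → ∥ Y ⊞ B ∥ ℕ.≤ k ℕ.* length Y →
      ∃[ X ] X ⊆ Y × Unique X × 0 ℕ.< length X × ∥ X ⊞ B ∥ ℕ.≤ k ℕ.* length X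
        × (∀ C → ∥ (X ⊞ C) ⊞ B ∥ ℕ.≤ k ℕ.* ∥ X ⊞ C ∥)
    petridis k Y Y! 0<Y bound with minimal-subset k (length Y) Y ℕ.≤-refl Y! 0<Y bound
    ... | X , X⊆ , X! , 0<X , boundX , minimal = X , X⊆ , X! , 0<X , boundX , λ C →
      ℕ.*-cancelʳ-≤ ∥ (X ⊞ C) ⊞ B ∥ (k ℕ.* ∥ X ⊞ C ∥) (length X) {{ℕ.>-nonZero 0<X}} (begin
        ∥ (X ⊞ C) ⊞ B ∥ ℕ.* length X     ≤⟨ induct C ⟩
        ∥ X ⊞ B ∥ ℕ.* ∥ X ⊞ C ∥          ≤⟨ ℕ.*-monoˡ-≤ ∥ X ⊞ C ∥ boundX ⟩
        k ℕ.* length X ℕ.* ∥ X ⊞ C ∥     ≡⟨ ℕ.*-assoc k (length X) ∥ X ⊞ C ∥ ⟩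
        k ℕ.* (length X ℕ.* ∥ X ⊞ C ∥)   ≡⟨ ≡.cong (k ℕ.*_) (ℕ.*-comm (length X) ∥ X ⊞ C ∥) ⟩
        k ℕ.* (∥ X ⊞ C ∥ ℕ.* length X)   ≡⟨ ℕ.*-assoc k ∥ X ⊞ C ∥ (length X) ⟨
        k ℕ.* ∥ X ⊞ C ∥ ℕ.* length X     ∎)
      where
      open ℕ.≤-Reasoning
      induct : ∀ C → ∥ (X ⊞ C) ⊞ B ∥ ℕ.* length X ℕ.≤ ∥ X ⊞ B ∥ ℕ.* ∥ X ⊞ C ∥
      induct [] = ℕ.≤-trans (ℕ.*-monoˡ-≤ (length X) (∥∥≤ {(X ⊞ []) ⊞ B} {[]} empty)) z≤n
        where
        empty : (X ⊞ []) ⊞ B ⊆ []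
        empty z∈ with ⊞⁻ (X ⊞ []) B z∈
        ... | w , _ , w∈ , _ with ⊞⁻ X [] w∈
        ...   | _ , _ , _ , () , _
      induct (c ∷ C) = petridis-step X! minimal c C (induct C)

-- Coverings by translates

-- Opaque, so that exponents in the hundreds are never unfolded.
opaque

  pow : ℕ → ℕ → ℕ
  pow κ e = κ ℕ.^ e

  pow≡^ : ∀ κ e → pow κ e ≡ κ ℕ.^ e
  pow≡^ κ e = ≡.refl

  pow-0 : ∀ κ → pow κ 0 ≡ 1
  pow-0 κ = ≡.refl

  pow-1 : ∀ κ → pow κ 1 ≡ κ
  pow-1 = ℕ.*-identityʳ

  pow-+ : ∀ κ e f → pow κ e ℕ.* pow κ f ≡ pow κ (e ℕ.+ f)
  pow-+ κ e f = ≡.sym (ℕ.^-distribˡ-+-* κ e f)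

  pow-mono : ∀ κ {e f} → 1 ℕ.≤ κ → e ℕ.≤ f → pow κ e ℕ.≤ pow κ f
  pow-mono κ@(suc _) _ = ℕ.^-monoʳ-≤ κ

  pow-pos : ∀ κ e → 1 ℕ.≤ κ → 0 ℕ.< pow κ e
  pow-pos κ@(suc _) e _ = ℕ.m^n>0 κ e

pow-*-≤ : ∀ κ e f {l m n} → l ℕ.≤ pow κ e ℕ.* m → m ℕ.≤ pow κ f ℕ.* n → l ℕ.≤ pow κ (e ℕ.+ f) ℕ.* n
pow-*-≤ κ e f {l} {m} {n} p q = begin
  l                              ≤⟨ p ⟩
  pow κ e ℕ.* m                  ≤⟨ ℕ.*-monoʳ-≤ (pow κ e) q ⟩
  pow κ e ℕ.* (pow κ f ℕ.* n)    ≡⟨ ℕ.*-assoc (pow κ e) (pow κ f) n ⟨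
  pow κ e ℕ.* pow κ f ℕ.* n      ≡⟨ ≡.cong (ℕ._* n) (pow-+ κ e f) ⟩
  pow κ (e ℕ.+ f) ℕ.* n          ∎
  where open ℕ.≤-Reasoning

module Covers (em : ∀ {a} → ExcludedMiddle a) (κ : ℕ) {c ℓ} (G : AbelianGroup c ℓ) where

  open AbelianGroup G renaming (_∙_ to infixl 6 _+_; ∙-cong to +-cong; ∙-congˡ to +-congˡ; ∙-congʳ to +-congʳ; _⁻¹ to -_; ⁻¹-cong to -‿cong; ε to 0#)
  open AbelianGroupSolver G
  open Finite em
  open OnSetoid setoid
  open Sumsets em G

  infix 4 _≲[_]_

  -- The number of translates is recorded by an exponent to the base κ, so that composing coverings
  -- adds exponents.
  record _≲[_]_ (U : List Carrier) (e : ℕ) (V : List Carrier) : Set (c ⊔ ℓ) where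
    constructor covered-by
    field
      translates : List Carrier
      few        : length translates ℕ.≤ pow κ e
      covered    : U ⊆ V ⊞ translates

  ⊆⇒≲ : ∀ {U V} → U ⊆ V → U ≲[ 0 ] V
  ⊆⇒≲ sub = covered-by (0# ∷ []) (ℕ.≤-reflexive (≡.sym (pow-0 κ))) λ u∈ → ∈-resp (identityʳ _) (⊞⁺ (sub u∈) (here refl))

  ≲-weaken : ∀ {U V e f} → 1 ℕ.≤ κ → e ℕ.≤ f → U ≲[ e ] V → U ≲[ f ] V
  ≲-weaken 1≤κ e≤f (covered-by L le sub) = covered-by L (ℕ.≤-trans le (pow-mono κ 1≤κ e≤f)) sub

  ⊆-≲ : ∀ {U U′ V e} → U ⊆ U′ → U′ ≲[ e ] V → U ≲[ e ] V
  ⊆-≲ p (covered-by L le sub) = covered-by L le (sub ∘ p)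

  ≲-⊆ : ∀ {U V V′ e} → U ≲[ e ] V → V ⊆ V′ → U ≲[ e ] V′
  ≲-⊆ {V = V} (covered-by L le sub) p = covered-by L le (⊞-mono {V = L} p id ∘ sub)

  length-product : ∀ {e f} (f′ : Carrier → Carrier → Carrier) L M → length L ℕ.≤ pow κ e → length M ℕ.≤ pow κ f →
    length (cartesianProductWith f′ L M) ℕ.≤ pow κ (e ℕ.+ f)
  length-product {e} {f} f′ L M p q = ℕ.≤-trans (ℕ.≤-reflexive (length-cartesianProductWith f′ L M))
    (ℕ.≤-trans (ℕ.*-mono-≤ p q) (ℕ.≤-reflexive (pow-+ κ e f)))

  ≲-trans : ∀ {U V W e f} → U ≲[ e ] V → V ≲[ f ] W → U ≲[ e ℕ.+ f ] W
  ≲-trans {U} {V} {W} (covered-by L p sub) (covered-by M q sub′) = covered-by (L ⊞ M) (length-product _+_ L M p q) λ u∈ →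
    let (v , l , v∈ , l∈ , e) = ⊞⁻ V L (sub u∈)
        (w , m , w∈ , m∈ , f) = ⊞⁻ W M (sub′ v∈)
    in ∈-resp (sym (trans e (trans (+-congʳ f)
         (solveₐ (v₀ ⊕ v₁ ⊕ v₂) (v₀ ⊕ (v₂ ⊕ v₁)) ≡.refl (w ∷ m ∷ l ∷ []))))) (⊞⁺ w∈ (⊞⁺ l∈ m∈))

  ≲-⊟ : ∀ {U V U′ V′ e f} → U ≲[ e ] V → U′ ≲[ f ] V′ → U ⊟ U′ ≲[ e ℕ.+ f ] V ⊟ V′
  ≲-⊟ {U} {V} {U′} {V′} (covered-by L p sub) (covered-by M q sub′) = covered-by (L ⊟ M) (length-product _-_ L M p q) λ z∈ →
    let (u , u′ , u∈ , u′∈ , e) = ⊟⁻ U U′ z∈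
        (v , l , v∈ , l∈ , f) = ⊞⁻ V L (sub u∈)
        (v′ , l′ , v′∈ , l′∈ , g) = ⊞⁻ V′ M (sub′ u′∈)
    in ∈-resp (sym (trans e (trans (-‿cong₂ f g)
         (solveₐ (v₀ ⊕ v₁ ⊖ (v₂ ⊕ v₃)) ((v₀ ⊖ v₂) ⊕ (v₁ ⊖ v₃)) ≡.refl (v ∷ l ∷ v′ ∷ l′ ∷ [])))))
         (⊞⁺ (⊟⁺ v∈ v′∈) (⊟⁺ l∈ l′∈))

  covering-≲ : ∀ {U p P} e → Unique P → p ∈ P → ∥ U ⊞ P ∥ ℕ.≤ pow κ e ℕ.* length P → U ≲[ e ] P ⊟ P
  covering-≲ {U} {p} {P} e P! p∈ le =
    let (Y , le′ , sub) = ruzsa-covering U P! p∈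
    in covered-by Y (ℕ.*-cancelʳ-≤ (length Y) (pow κ e) (length P) {{ℕ.>-nonZero (∈⇒0<length p∈)}} (ℕ.≤-trans le′ le)) sub

  -- With G = X - X this bounds |(G - G) + X|, which is exactly what Ruzsa covering by X needs in
  -- order to cover G - G by few translates of G.
  SmallDifferences : ℕ → List Carrier → Set
  SmallDifferences k X = ∥ ((X ⊟ X) ⊟ (X ⊟ X)) ⊞ X ∥ ℕ.≤ pow κ k ℕ.* length X

  -- The last exponent is 5k, namely 3k from fourfold and 2k from threefold sums of X; for k = 4 it
  -- evaluates to 20.
  IsCore : ℕ → List Carrier → List Carrier → Set (c ⊔ ℓ)
  IsCore k B X = X ⊆ B × Unique X × 0 ℕ.< length X × length B ℕ.≤ pow κ k ℕ.* length X
    × SmallDifferences ((k ℕ.+ (k ℕ.+ k)) ℕ.+ (k ℕ.+ k)) X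

  -- Regroup x₁ - x₂ - (x₃ - x₄) + x as (x₁ + x₄ + x) - (x₂ + x₃). The Ruzsa triangle inequality
  -- with pivot X then leaves the fourfold and threefold sums of X, which Petridis's lemma bounds by
  -- κ^3k |X| and κ^2k |X|.
  small-doubling : ∀ k B → Unique B → 0 ℕ.< length B → ∥ B ⊞ B ∥ ℕ.≤ pow κ k ℕ.* length B →
    ∃[ X ] IsCore k B X
  small-doubling k B B! 0<B bound = finish (petridis B (pow κ k) B B! 0<B bound)
    where
    finish : (∃[ X ] X ⊆ B × Unique X × 0 ℕ.< length X × ∥ X ⊞ B ∥ ℕ.≤ pow κ k ℕ.* length X
               × (∀ C → ∥ (X ⊞ C) ⊞ B ∥ ℕ.≤ pow κ k ℕ.* ∥ X ⊞ C ∥)) →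
             ∃[ X ] IsCore k B X
    finish (X , X⊆ , X! , 0<X , XB , plünnecke) = X , X⊆ , X! , 0<X
      , ℕ.≤-trans (length≤∥⊞∥ {U = X} (∈ₚ⇒∈ (proj₂ (first 0<X))) B!) XB
      , ℕ.*-cancelʳ-≤ ∥ D ⊞ X ∥ (pow κ (3k ℕ.+ 2k) ℕ.* length X) (length X) {{ℕ.>-nonZero 0<X}} (begin
        ∥ D ⊞ X ∥ ℕ.* length X        ≤⟨ ℕ.*-monoˡ-≤ (length X) (∥∥-mono differences) ⟩
        ∥ (X ⊞ X²) ⊟ X² ∥ ℕ.* length X ≤⟨ ruzsa-triangle (X ⊞ X²) X² X! ⟩
        ∥ (X ⊞ X²) ⊞ X ∥ ℕ.* ∥ X² ⊞ X ∥ ≤⟨ ℕ.*-mono-≤ X⁴ X³ ⟩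
        (pow κ 3k ℕ.* length X) ℕ.* (pow κ 2k ℕ.* length X) ≡⟨ interchange (pow κ 3k) _ _ _ ⟩
        (pow κ 3k ℕ.* pow κ 2k) ℕ.* (length X ℕ.* length X) ≡⟨ ≡.cong (ℕ._* (length X ℕ.* length X)) (pow-+ κ 3k 2k) ⟩
        pow κ (3k ℕ.+ 2k) ℕ.* (length X ℕ.* length X) ≡⟨ ℕ.*-assoc (pow κ (3k ℕ.+ 2k)) (length X) (length X) ⟨
        pow κ (3k ℕ.+ 2k) ℕ.* length X ℕ.* length X ∎)
      where
      open ℕ.≤-Reasoning
      open CommutativeSemigroupₚ ℕ.*-commutativeSemigroup using (interchange)
      2k = k ℕ.+ k
      3k = k ℕ.+ 2k
      X² = X ⊞ X
      D = (X ⊟ X) ⊟ (X ⊟ X)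
      X²≤ : ∥ X² ∥ ℕ.≤ pow κ k ℕ.* length X
      X²≤ = ℕ.≤-trans (∥∥-mono (⊞-mono {X} {V = X} id X⊆)) XB
      X³ : ∥ X² ⊞ X ∥ ℕ.≤ pow κ 2k ℕ.* length X
      X³ = pow-*-≤ κ k k (ℕ.≤-trans (∥∥-mono (⊞-mono {X²} {V = X} id X⊆)) (plünnecke X)) X²≤
      X⁴ : ∥ (X ⊞ X²) ⊞ X ∥ ℕ.≤ pow κ 3k ℕ.* length X
      X⁴ = pow-*-≤ κ k 2k (ℕ.≤-trans (∥∥-mono (⊞-mono {X ⊞ X²} {V = X} id X⊆)) (plünnecke X²))
        (ℕ.≤-trans (∥∥-mono swap) X³)
        where
        swap : X ⊞ X² ⊆ X² ⊞ X
        swap z∈ = let (x , y , x∈ , y∈ , e) = ⊞⁻ X X² z∈ in ∈-resp (sym (trans e (comm x y))) (⊞⁺ y∈ x∈)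
      differences : D ⊞ X ⊆ (X ⊞ X²) ⊟ X²
      differences z∈ =
        let (d , x , d∈ , x∈ , e) = ⊞⁻ D X z∈
            (g , h , g∈ , h∈ , f) = ⊟⁻ (X ⊟ X) (X ⊟ X) d∈
            (x₁ , x₂ , x₁∈ , x₂∈ , p) = ⊟⁻ X X g∈
            (x₃ , x₄ , x₃∈ , x₄∈ , q) = ⊟⁻ X X h∈
        in ∈-resp (sym (trans e (trans (+-congʳ (trans f (-‿cong₂ p q)))
             (solveₐ (v₀ ⊖ v₁ ⊖ (v₂ ⊖ v₃) ⊕ v₄) (v₀ ⊕ (v₃ ⊕ v₄) ⊖ (v₁ ⊕ v₂)) ≡.refl (x₁ ∷ x₂ ∷ x₃ ∷ x₄ ∷ x ∷ [])))))
             (⊟⁺ (⊞⁺ x₁∈ (⊞⁺ x₄∈ x∈)) (⊞⁺ x₂∈ x₃∈))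

-- Dilates in rings

module Dilates (em : ∀ {a} → ExcludedMiddle a) (κ : ℕ) {c ℓ} (R : Ring c ℓ) where

  open Ring R
  open RingSubsets R using (IsInvertible)
  open Ringₚ R using (x[y-z]≈xy-xz; [y-z]x≈yx-zx)
  open Finite em
  open OnSetoid setoid
  open Sumsets em +-abelianGroup
  open Covers em κ +-abelianGroup

  dilate : Carrier → List Carrier → List Carrier
  dilate r = map (r *_)

  dilate⁺ : ∀ {r u U} → u ∈ U → r * u ∈ dilate r U
  dilate⁺ = Membershipₚ.∈-map⁺ setoid setoid *-congˡ

  dilate⁻ : ∀ {r z U} → z ∈ dilate r U → ∃[ u ] u ∈ U × z ≈ r * u
  dilate⁻ = Membershipₚ.∈-map⁻ setoid setoid

  dilate-cong : ∀ {r s U} → r ≈ s → dilate r U ⊆ dilate s U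
  dilate-cong e z∈ = let (u , u∈ , f) = dilate⁻ z∈ in ∈-resp (sym (trans f (*-congʳ e))) (dilate⁺ u∈)

  dilate-mono : ∀ {r U V} → U ⊆ V → dilate r U ⊆ dilate r V
  dilate-mono sub z∈ = let (u , u∈ , f) = dilate⁻ z∈ in ∈-resp (sym f) (dilate⁺ (sub u∈))

  dilate-*⇒∘ : ∀ r s {U} → dilate (r * s) U ⊆ dilate r (dilate s U)
  dilate-*⇒∘ r s z∈ = let (u , u∈ , f) = dilate⁻ z∈ in
    ∈-resp (sym (trans f (*-assoc r s u))) (dilate⁺ (dilate⁺ u∈))

  dilate-∘⇒* : ∀ r s {U} → dilate r (dilate s U) ⊆ dilate (r * s) U
  dilate-∘⇒* r s z∈ =
    let (v , v∈ , e) = dilate⁻ z∈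
        (u , u∈ , f) = dilate⁻ v∈
    in ∈-resp (sym (trans e (trans (*-congˡ f) (sym (*-assoc r s u))))) (dilate⁺ u∈)

  dilate-⊟⇒ : ∀ r U V → dilate r (U ⊟ V) ⊆ dilate r U ⊟ dilate r V
  dilate-⊟⇒ r U V z∈ =
    let (w , w∈ , e) = dilate⁻ z∈
        (u , v , u∈ , v∈ , f) = ⊟⁻ U V w∈
    in ∈-resp (sym (trans e (trans (*-congˡ f) (x[y-z]≈xy-xz r u v)))) (⊟⁺ (dilate⁺ u∈) (dilate⁺ v∈))

  dilate-⊟⇐ : ∀ r U V → dilate r U ⊟ dilate r V ⊆ dilate r (U ⊟ V)
  dilate-⊟⇐ r U V z∈ =
    let (u′ , v′ , u′∈ , v′∈ , e) = ⊟⁻ (dilate r U) (dilate r V) z∈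
        (u , u∈ , f) = dilate⁻ u′∈
        (v , v∈ , g) = dilate⁻ v′∈
    in ∈-resp (sym (trans e (trans (-‿cong₂ f g) (sym (x[y-z]≈xy-xz r u v))))) (dilate⁺ (⊟⁺ u∈ v∈))

  dilate-difference : ∀ r s {U} → dilate (r - s) U ⊆ dilate r U ⊟ dilate s U
  dilate-difference r s z∈ = let (u , u∈ , e) = dilate⁻ z∈ in
    ∈-resp (sym (trans e ([y-z]x≈yx-zx u r s))) (⊟⁺ (dilate⁺ u∈) (dilate⁺ u∈))

  dilate-≲ : ∀ {U V e} r → U ≲[ e ] V → dilate r U ≲[ e ] dilate r V
  dilate-≲ {U} {V} r (covered-by L le sub) = covered-by (dilate r L) (ℕ.≤-trans (ℕ.≤-reflexive (length-map (r *_) L)) le) λ z∈ →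
    let (u , u∈ , e) = dilate⁻ z∈
        (v , l , v∈ , l∈ , f) = ⊞⁻ V L (sub u∈)
    in ∈-resp (sym (trans e (trans (*-congˡ f) (distribˡ r v l)))) (⊞⁺ (dilate⁺ v∈) (dilate⁺ l∈))

  ∥dilate-⊞∥ : ∀ r U V → ∥ dilate r U ⊞ dilate r V ∥ ℕ.≤ ∥ U ⊞ V ∥
  ∥dilate-⊞∥ r U V = ≡.subst (∥ dilate r U ⊞ dilate r V ∥ ℕ.≤_) (length-map (r *_) (dedup (U ⊞ V))) (∥∥≤ λ z∈ →
    let (u′ , v′ , u′∈ , v′∈ , e) = ⊞⁻ (dilate r U) (dilate r V) z∈
        (u , u∈ , f) = dilate⁻ u′∈
        (v , v∈ , g) = dilate⁻ v′∈
    in ∈-resp (sym (trans e (trans (+-cong f g) (sym (distribˡ r u v))))) (dilate⁺ (dedup⁺ (⊞⁺ u∈ v∈))))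

  x-0≈x : ∀ x → x - 0# ≈ x
  x-0≈x x = trans (+-congˡ (trans (sym (+-identityˡ _)) (-‿inverseʳ 0#))) (+-identityʳ x)

  invertible-resp : ∀ {r s} → r ≈ s → IsInvertible r → IsInvertible s
  invertible-resp e (i , p , q) = i , trans (*-congˡ (sym e)) p , trans (*-congʳ (sym e)) q

  cancel : ∀ {r i} x → i * r ≈ 1# → i * (r * x) ≈ x
  cancel x p = trans (sym (*-assoc _ _ x)) (trans (*-congʳ p) (*-identityˡ x))

  *-cancelˡ : ∀ {r x y} → IsInvertible r → r * x ≈ r * y → x ≈ y
  *-cancelˡ {r} {x} {y} (i , p , _) e = trans (sym (cancel x p)) (trans (*-congˡ e) (cancel y p))

  dilate-unique : ∀ {r U} → IsInvertible r → Unique U → Unique (dilate r U)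
  dilate-unique inv = Uniqueₚ.map⁺ setoid setoid (*-cancelˡ inv)

  -- Let P = rA ∩ sA. As a subset of rA it satisfies |rA + P| ≤ |A + A|, so Ruzsa covering covers rA
  -- by few translates of P - P; as a subset of sA it has P - P inside s(A - A).
  common⇒≲ : ∀ {r s A} e → IsInvertible r → Unique A → 0 ℕ.< length A → ∀ k →
    ∥ A ⊞ A ∥ ℕ.≤ pow κ k ℕ.* length A → length A ℕ.≤ pow κ e ℕ.* length (dilate r A ∩ dilate s A) →
    dilate r A ≲[ k ℕ.+ e ] dilate s (A ⊟ A)
  common⇒≲ {r} {s} {A} e inv A! 0<A k sum common with dilate r A ∩ dilate s A in eq
  ... | [] = contradiction (ℕ.≤-trans common (ℕ.≤-reflexive (ℕ.*-zeroʳ (pow κ e)))) (ℕ.<⇒≱ 0<A)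
  ... | P@(p ∷ _) = ≲-⊆ (covering-≲ (k ℕ.+ e) P! (here refl)
          (pow-*-≤ κ k e (ℕ.≤-trans (ℕ.≤-trans (∥∥-mono (⊞-mono {dilate r A} {V = P} id (proj₁ ∘ P⁻))) (∥dilate-⊞∥ r A A)) sum) common))
        (dilate-⊟⇐ s A A ∘ ⊟-mono {P} {V = P} (proj₂ ∘ P⁻) (proj₂ ∘ P⁻))
    where
    P! : Unique P
    P! = ≡.subst Unique eq (Uniqueₚ.filter⁺ setoid (decide (_∈ dilate s A)) (dilate-unique inv A!))
    P⁻ : ∀ {z} → z ∈ P → z ∈ dilate r A × z ∈ dilate s A
    P⁻ {z} z∈ = select⁻ {P = _∈ dilate s A} ∈-resp {z} {dilate r A} (≡.subst (z ∈_) (≡.sym eq) z∈)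

-- A dilate that overlaps with many others

module PopularDilate (em : ∀ {a} → ExcludedMiddle a) (κ : ℕ) (2≤κ : 2 ℕ.≤ κ) {c ℓ} (R : Ring c ℓ)
  (A : List (Ring.Carrier R)) where

  open Ring R
  open RingSubsets R using (IsInvertible)
  open Finite em
  open OnSetoid setoid
  open Dilates em κ R

  1≤κ : 1 ℕ.≤ κ
  1≤κ = ℕ.≤-trans (s≤s z≤n) 2≤κ

  pow-suc : ∀ e → 2 ℕ.* pow κ e ℕ.≤ pow κ (suc e)
  pow-suc e = ℕ.≤-trans (ℕ.*-monoˡ-≤ (pow κ e) 2≤κ) (ℕ.≤-reflexive
    (≡.trans (≡.cong (ℕ._* pow κ e) (≡.sym (pow-1 κ))) (pow-+ κ 1 e)))

  Popular : Carrier → Carrier → Set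
  Popular a b = length A ℕ.≤ pow κ 4 ℕ.* length (dilate a A ∩ dilate b A)

  popular-refl : ∀ a → Popular a a
  popular-refl a = ≡.subst (λ l → length A ℕ.≤ pow κ 4 ℕ.* l)
    (≡.trans (≡.sym (length-map (a *_) A)) (≡.cong length (≡.sym (filter-all (decide (_∈ dilate a A)) (All.tabulate ∈ₚ⇒∈)))))
    (ℕ.m≤n*m (length A) (pow κ 4) {{ℕ.>-nonZero (pow-pos κ 4 1≤κ)}})

  module _ (A! : Unique A) (0<A : 0 ℕ.< length A)
    (product : ∥ cartesianProductWith _*_ A A ∥ ℕ.≤ pow κ 1 ℕ.* length A)
    (xs : List Carrier) (units : ∀ {x} → x ∈ₚ xs → x ∈ₚ A × IsInvertible x) where

    -- These would be κ² subsets of A·A of size |A| with pairwise overlaps at most |A|/κ⁴, so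
    -- Bonferroni would give κ²|A| ≤ κ|A| + |A|, which is false for κ ≥ 2. The computation is
    -- multiplied by q = κ⁴ to clear the denominator.
    few-unpopular : ∀ ys → (∀ {y} → y ∈ₚ ys → y ∈ₚ xs) → AllPairs (λ x y → ¬ Popular x y) ys →
      ¬ (length ys ≡ pow κ 2)
    few-unpopular ys sub pairs t≡ = ℕ.<⇒≱ gap (ℕ.*-cancelʳ-≤ (pow κ 6) (pow κ 5 ℕ.+ pow κ 4) n {{ℕ.>-nonZero 0<A}} (begin
      pow κ 6 ℕ.* n
        ≡⟨ regroup 4 2 n ⟨
      q ℕ.* (pow κ 2 ℕ.* n)
        ≡⟨ ≡.cong (λ t → q ℕ.* (t ℕ.* n)) t≡ ⟨
      q ℕ.* (length ys ℕ.* n)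
        ≤⟨ ℕ.*-monoʳ-≤ q (almost-disjoint (λ a → dilate a A) n m Z ys hyp (AllPairs.map small pairs)) ⟩
      q ℕ.* (∥ Z ∥ ℕ.+ length ys ℕ.* (length ys ℕ.* m))
        ≡⟨ ℕ.*-distribˡ-+ q ∥ Z ∥ _ ⟩
      q ℕ.* ∥ Z ∥ ℕ.+ q ℕ.* (length ys ℕ.* (length ys ℕ.* m))
        ≡⟨ ≡.cong (λ t → q ℕ.* ∥ Z ∥ ℕ.+ q ℕ.* (t ℕ.* (t ℕ.* m))) t≡ ⟩
      q ℕ.* ∥ Z ∥ ℕ.+ q ℕ.* (pow κ 2 ℕ.* (pow κ 2 ℕ.* m))
        ≡⟨ ≡.cong (λ t → q ℕ.* ∥ Z ∥ ℕ.+ q ℕ.* t) (regroup 2 2 m) ⟩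
      q ℕ.* ∥ Z ∥ ℕ.+ q ℕ.* (q ℕ.* m)
        ≤⟨ ℕ.+-mono-≤ (ℕ.*-monoʳ-≤ q product) (ℕ.*-monoʳ-≤ q (ℕ.≤-trans (ℕ.≤-reflexive (ℕ.*-comm q m)) (ℕ.m/n*n≤m n q))) ⟩
      q ℕ.* (pow κ 1 ℕ.* n) ℕ.+ q ℕ.* n
        ≡⟨ ≡.cong (ℕ._+ q ℕ.* n) (regroup 4 1 n) ⟩
      pow κ 5 ℕ.* n ℕ.+ pow κ 4 ℕ.* n
        ≡⟨ ℕ.*-distribʳ-+ n (pow κ 5) (pow κ 4) ⟨
      (pow κ 5 ℕ.+ pow κ 4) ℕ.* n ∎))
      where
      open ℕ.≤-Reasoning
      n = length A
      q = pow κ 4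
      instance
        q≢0 : ℕ.NonZero q
        q≢0 = ℕ.>-nonZero (pow-pos κ 4 1≤κ)
      m = n ℕ./ q
      Z = cartesianProductWith _*_ A A
      regroup : ∀ e f l → pow κ e ℕ.* (pow κ f ℕ.* l) ≡ pow κ (e ℕ.+ f) ℕ.* l
      regroup e f l = ≡.trans (≡.sym (ℕ.*-assoc (pow κ e) (pow κ f) l)) (≡.cong (ℕ._* l) (pow-+ κ e f))
      hyp : ∀ {a} → a ∈ₚ ys → Unique (dilate a A) × n ℕ.≤ length (dilate a A) × dilate a A ⊆ Z
      hyp {a} a∈ = dilate-unique (proj₂ (units (sub a∈))) A! , ℕ.≤-reflexive (≡.sym (length-map (a *_) A)) , λ z∈ →
        let (x , x∈ , e) = dilate⁻ z∈ in ∈-resp (sym e)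
          (Membershipₚ.∈-cartesianProductWith⁺ setoid setoid setoid *-cong (∈ₚ⇒∈ (proj₁ (units (sub a∈)))) x∈)
      small : ∀ {a b} → ¬ Popular a b → length (dilate a A ∩ dilate b A) ℕ.≤ m
      small {a} {b} unpopular = ≡.subst (ℕ._≤ m) (ℕ.m*n/n≡m l q)
        (ℕ./-monoˡ-≤ q (ℕ.≤-trans (ℕ.≤-reflexive (ℕ.*-comm l q)) (ℕ.<⇒≤ (ℕ.≰⇒> unpopular))))
        where l = length (dilate a A ∩ dilate b A)
      gap : pow κ 5 ℕ.+ pow κ 4 ℕ.< pow κ 6
      gap = begin-strict
        pow κ 5 ℕ.+ pow κ 4 <⟨ ℕ.+-monoʳ-< (pow κ 5) (ℕ.<-≤-trans
          (ℕ.m<n+m q (pow-pos κ 4 1≤κ)) (ℕ.≤-trans (ℕ.≤-reflexive (≡.cong (q ℕ.+_) (≡.sym (ℕ.+-identityʳ q)))) (pow-suc 4))) ⟩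
        pow κ 5 ℕ.+ pow κ 5 ≡⟨ ≡.cong (pow κ 5 ℕ.+_) (ℕ.+-identityʳ (pow κ 5)) ⟨
        2 ℕ.* pow κ 5       ≤⟨ pow-suc 5 ⟩
        pow κ 6             ∎

    -- A greedy net of pairwise unpopular elements has fewer than κ² members, since a longer one
    -- could be truncated to exactly κ². Pigeonhole over the net then yields b.
    popular-dilate : ∀ {x} → x ∈ₚ xs →
      ∃[ b ] b ∈ₚ xs × length xs ℕ.≤ pow κ 2 ℕ.* length (fibre Popular b xs)
    popular-dilate x∈ =
      let (ys , sub , pairs , cov) = greedy Popular popular-refl xs
          (b , b∈ , le) = pigeonhole Popular xs ys x∈ cov
      in b , sub b∈ , ℕ.≤-trans le (ℕ.*-monoˡ-≤ _ (ℕ.<⇒≤ (ℕ.≰⇒> λ t≤ →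
           few-unpopular (take (pow κ 2) ys) (sub ∘ ∈-take⁻ (pow κ 2) ys) (AllPairsₚ.take⁺ (pow κ 2) pairs)
             (≡.trans (length-take (pow κ 2) ys) (ℕ.m≤n⇒m⊓n≡m t≤)))))

-- Near-stabilisers of the approximate group X - X

module Stabiliser (em : ∀ {a} → ExcludedMiddle a) (κ : ℕ) (1≤κ : 1 ℕ.≤ κ) {c ℓ} (R : Ring c ℓ)
  (X : List (Ring.Carrier R)) (X! : UniqueSetoid.Unique (Ring.setoid R) X) (0<X : 0 ℕ.< length X)
  (differences : Covers.SmallDifferences em κ (Ring.+-abelianGroup R) 20 X)
  where

  open Ring R
  open RingSubsets R using (IsInvertible)
  open Ringₚ R using (x[y-z]≈xy-xz; [y-z]x≈yx-zx)
  open AbelianGroupSolver +-abelianGroup using (solveₐ; _⊕_; _⊖_)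
  open Finite em
  open OnSetoid setoid
  open Sumsets em +-abelianGroup
  open Covers em κ +-abelianGroup
  open Dilates em κ R

  G : List Carrier
  G = X ⊟ X

  -- A base point: X - x₀ is a copy of X inside G, so that pigeonhole and covering arguments about G
  -- can run over the duplicate-free list X.
  x₀ : Carrier
  x₀ = proj₁ (first {xs = X} 0<X)

  x₀∈ₚ : x₀ ∈ₚ X
  x₀∈ₚ = proj₂ (first {xs = X} 0<X)

  x₀∈ : x₀ ∈ X
  x₀∈ = ∈ₚ⇒∈ x₀∈ₚ

  0∈G : 0# ∈ G
  0∈G = ∈-resp (-‿inverseʳ x₀) (⊟⁺ x₀∈ x₀∈)

  -G : ∀ {g} → g ∈ G → 0# - g ∈ G
  -G g∈ = let (x , y , x∈ , y∈ , e) = ⊟⁻ X X g∈ in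
    ∈-resp (sym (trans (-‿cong₂ (sym (-‿inverseʳ y)) e) (solveₐ (v₁ ⊖ v₁ ⊖ (v₀ ⊖ v₁)) (v₁ ⊖ v₀) ≡.refl (x ∷ y ∷ []))))
      (⊟⁺ y∈ x∈)

  G⊟G≲G : G ⊟ G ≲[ 20 ] G
  G⊟G≲G = covering-≲ 20 X! x₀∈ differences

  ∥G⊟G∥≤ : ∥ G ⊟ G ∥ ℕ.≤ pow κ 20 ℕ.* length X
  ∥G⊟G∥≤ = ℕ.≤-trans (≡.subst (ℕ._≤ ∥ (G ⊟ G) ⊞ X ∥) (length-map (x₀ +_) (dedup (G ⊟ G)))
    (unique≤∥∥ (translate-unique x₀ (dedup-unique (G ⊟ G))) λ z∈ →
      let (g , g∈ , e) = translate⁻ x₀ z∈ in ∈-resp (sym (trans e (+-comm x₀ g))) (⊞⁺ (dedup⁻ g∈) x₀∈)))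
    differences

  -- (a - a′)G lies in aG - a′G, hence in few translates of b(G - G); the summand 20 is the cost of
  -- returning from G - G to G.
  dilate-G-difference : ∀ {a a′ b e f} → dilate a G ≲[ e ] dilate b G → dilate a′ G ≲[ f ] dilate b G →
    dilate (a - a′) G ≲[ e ℕ.+ f ℕ.+ 20 ] dilate b G
  dilate-G-difference {a} {a′} {b} p q = ⊆-≲ (dilate-difference a a′)
    (≲-trans (≲-⊆ (≲-⊟ p q) (dilate-⊟⇐ b G G)) (dilate-≲ b G⊟G≲G))

  dilate-G-* : ∀ {a b e} r → dilate a G ≲[ e ] dilate b G → dilate (r * a) G ≲[ e ] dilate (r * b) G
  dilate-G-* {a} {b} r p = ≲-⊆ (⊆-≲ (dilate-*⇒∘ r a) (dilate-≲ r p)) (dilate-∘⇒* r b)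

  -- The set S_M of the overview for M = κ^e.
  Stab : ℕ → Carrier → Set (c ⊔ ℓ)
  Stab e r = dilate r G ≲[ e ] G

  stab-resp : ∀ {e r s} → r ≈ s → Stab e r → Stab e s
  stab-resp e = ⊆-≲ (dilate-cong (sym e))

  stab-weaken : ∀ {e f r} → e ℕ.≤ f → Stab e r → Stab f r
  stab-weaken = ≲-weaken 1≤κ

  dilate-1 : dilate 1# G ⊆ G
  dilate-1 z∈ = let (g , g∈ , e) = dilate⁻ z∈ in ∈-resp (sym (trans e (*-identityˡ g))) g∈

  stab-of : ∀ {a b e} r → r * b ≈ 1# → dilate a G ≲[ e ] dilate b G → Stab e (r * a)
  stab-of r inv p = ≲-⊆ (dilate-G-* r p) (dilate-1 ∘ dilate-cong inv)

  stab-0 : Stab 0 0#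
  stab-0 = ⊆⇒≲ λ z∈ → let (g , _ , e) = dilate⁻ z∈ in ∈-resp (sym (trans e (zeroˡ g))) 0∈G

  stab-difference : ∀ {e f r s} → Stab e r → Stab f s → Stab (e ℕ.+ f ℕ.+ 20) (r - s)
  stab-difference {r = r} {s} p q = ⊆-≲ (dilate-difference r s) (≲-trans (≲-⊟ p q) G⊟G≲G)

  stab-* : ∀ {e f r s} → Stab e r → Stab f s → Stab (f ℕ.+ e) (r * s)
  stab-* {r = r} {s} p q = ⊆-≲ (dilate-*⇒∘ r s) (≲-trans (dilate-≲ r q) p)

  -- If dG is covered by few translates of bG, one translate contains a large part P of dX; then
  -- P covers bG, and P − P lies in dG.
  reversal : ∀ {b d e} → IsInvertible d → dilate d G ≲[ e ] dilate b G → dilate b G ≲[ 20 ℕ.+ e ] dilate d G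
  reversal {b} {d} {e} inv (covered-by L L≤ sub) = finish (pigeonhole ρ dX L (Propₚ.∈-map⁺ _ x₀∈ₚ) classify)
    where
    ρ : Carrier → Carrier → Set _
    ρ z l = ∃[ g ] g ∈ dilate b G × z ≈ g + l
    dX = map (λ x → d * (x - x₀)) X
    dX! : Unique dX
    dX! = Uniqueₚ.map⁺ setoid setoid (λ q → +-cancelʳ _ _ _ (*-cancelˡ inv q)) X!
      where open Ringₚ R using (+-cancelʳ)
    dX⁻ : ∀ {z} → z ∈ₚ dX → ∃[ x ] x ∈ X × z ≈ d * (x - x₀)
    dX⁻ z∈ = let (x , x∈ , q) = Propₚ.∈-map⁻ _ z∈ in x , ∈ₚ⇒∈ x∈ , reflexive q
    classify : ∀ {z} → z ∈ₚ dX → ∃[ l ] l ∈ₚ L × ρ z l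
    classify z∈ =
      let (x , x∈ , q) = dX⁻ z∈
          (g , l , g∈ , l∈ , r) = ⊞⁻ (dilate b G) L (sub (dilate⁺ (⊟⁺ x∈ x₀∈)))
          (l′ , l′∈ , l≈l′) = find l∈
      in l′ , l′∈ , g , g∈ , trans q (trans r (+-congˡ l≈l′))
    finish : (∃[ l ] l ∈ₚ L × length dX ℕ.≤ length L ℕ.* length (fibre ρ l dX)) → dilate b G ≲[ 20 ℕ.+ e ] dilate d G
    finish (l , l∈ , le) = ≲-⊆ (covering-≲ (20 ℕ.+ e) P! (∈ₚ⇒∈ (proj₂ (first 0<P))) small) P⊟P⊆
      where
      P = fibre ρ l dX
      P! : Unique P
      P! = Uniqueₚ.filter⁺ setoid (decide (λ z → ρ z l)) dX!
      P⁻ : ∀ {z} → z ∈ P → (∃[ x ] x ∈ X × z ≈ d * (x - x₀)) × ρ z l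
      P⁻ z∈ =
        let (z′ , z′∈ , q) = find z∈
            (z′∈dX , g , g∈ , r) = Propₚ.∈-filter⁻ (decide (λ z → ρ z l)) {xs = dX} z′∈
            (x , x∈ , s) = dX⁻ z′∈dX
        in (x , x∈ , trans q s) , g , g∈ , trans q r
      X≤ : length X ℕ.≤ pow κ e ℕ.* length P
      X≤ = ℕ.≤-trans (≡.subst (ℕ._≤ length L ℕ.* length P) (length-map _ X) le) (ℕ.*-monoˡ-≤ (length P) L≤)
      0<P : 0 ℕ.< length P
      0<P = ℕ.n≢0⇒n>0 λ eq → ℕ.<⇒≱ 0<X (ℕ.≤-trans X≤ (ℕ.≤-reflexive (≡.trans (≡.cong (pow κ e ℕ.*_) eq) (ℕ.*-zeroʳ (pow κ e)))))
      -- P lies in bG + l, so bG + P lies in b(G + G) + l, and G + G = G - G because G is symmetric.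
      small : ∥ dilate b G ⊞ P ∥ ℕ.≤ pow κ (20 ℕ.+ e) ℕ.* length P
      small = pow-*-≤ κ 20 e (ℕ.≤-trans (≡.subst (∥ dilate b G ⊞ P ∥ ℕ.≤_) (length-map shift (dedup (G ⊟ G))) (∥∥≤ covered)) ∥G⊟G∥≤) X≤
        where
        shift : Carrier → Carrier
        shift h = b * h + l
        covered : dilate b G ⊞ P ⊆ map shift (dedup (G ⊟ G))
        covered z∈ =
          let (u , p , u∈ , p∈ , q) = ⊞⁻ (dilate b G) P z∈
              (g , g∈ , r) = dilate⁻ u∈
              (_ , w , w∈ , s) = P⁻ p∈
              (g′ , g′∈ , t) = dilate⁻ w∈
          in ∈-resp (sym (trans q (trans (+-cong r (trans s (+-congʳ t))) (trans (sym (+-assoc _ _ l)) (+-congʳ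
               (trans (sym (distribˡ b g g′)) (*-congˡ (trans (solveₐ (v₀ ⊕ v₁) (v₀ ⊖ (v₂ ⊖ v₂ ⊖ v₁)) ≡.refl (g ∷ g′ ∷ 0# ∷ []))
                 (-‿cong₂ refl (+-congʳ (-‿inverseʳ 0#)))))))))))
               (Membershipₚ.∈-map⁺ setoid setoid (λ q → +-congʳ (*-congˡ q)) (dedup⁺ (⊟⁺ g∈ (-G g′∈))))
      P⊟P⊆ : P ⊟ P ⊆ dilate d G
      P⊟P⊆ z∈ =
        let (p , p′ , p∈ , p′∈ , q) = ⊟⁻ P P z∈
            ((x , x∈ , r) , _) = P⁻ p∈
            ((x′ , x′∈ , r′) , _) = P⁻ p′∈
        in ∈-resp (sym (trans q (trans (-‿cong₂ r r′) (trans (sym (x[y-z]≈xy-xz d _ _))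
             (*-congˡ (solveₐ (v₀ ⊖ v₂ ⊖ (v₁ ⊖ v₂)) (v₀ ⊖ v₁) ≡.refl (x ∷ x′ ∷ x₀ ∷ [])))))))
             (dilate⁺ (⊟⁺ x∈ x′∈))

  -- Pigeonhole: two of the r(x − x₀) fall into the same translate of G.
  stab-quotient : ∀ {e r} Is → (∀ {x} → x ∈ₚ Is → x ∈ X) → AllPairs (λ x y → ¬ ¬ IsInvertible (x - y)) Is →
    pow κ e ℕ.< length Is → Stab e r →
    ∃[ x ] ∃[ y ] x ∈ₚ Is × y ∈ₚ Is × IsInvertible (x - y) × r * (x - y) ∈ G ⊟ G
  stab-quotient {e} {r} Is Is⊆X pairs long (covered-by L L≤ sub) =
    let (x , y , l , x∈ , y∈ , ¬¬inv , (g , g∈ , p) , (g′ , g′∈ , q)) =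
          collision ρ Is L pairs classify (ℕ.≤-<-trans L≤ long)
    in x , y , x∈ , y∈ , decidable-stable em ¬¬inv , ∈-resp (begin
         g - g′                              ≈⟨ solveₐ (v₀ ⊖ v₁) (v₀ ⊕ v₂ ⊖ (v₁ ⊕ v₂)) ≡.refl (g ∷ g′ ∷ l ∷ []) ⟩
         (g + l) - (g′ + l)                  ≈⟨ -‿cong₂ p q ⟨
         r * (x - x₀) - r * (y - x₀)         ≈⟨ x[y-z]≈xy-xz r _ _ ⟨
         r * ((x - x₀) - (y - x₀))           ≈⟨ *-congˡ (solveₐ (v₀ ⊖ v₂ ⊖ (v₁ ⊖ v₂)) (v₀ ⊖ v₁) ≡.refl (x ∷ y ∷ x₀ ∷ [])) ⟩
         r * (x - y)                         ∎) (⊟⁺ g∈ g′∈)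
    where
    open SetoidReasoning setoid
    ρ : Carrier → Carrier → Set _
    ρ x l = ∃[ g ] g ∈ G × r * (x - x₀) ≈ g + l
    classify : ∀ {x} → x ∈ₚ Is → ∃[ l ] l ∈ₚ L × ρ x l
    classify x∈ =
      let (g , l , g∈ , l∈ , p) = ⊞⁻ G L (sub (dilate⁺ (⊟⁺ (Is⊆X x∈) x₀∈)))
          (l′ , l′∈ , q) = find l∈
      in l′ , l′∈ , g , g∈ , trans p (+-congˡ q)

  -- Made total by the default value `0#`, so that it can be mapped over all differences of `Is`,
  -- including the non-invertible x - x.
  inverse : Carrier → Carrier
  inverse d with em {P = IsInvertible d}
  ... | yes (d⁻¹ , _) = d⁻¹
  ... | no _ = 0#

  inverse-right : ∀ {d} → IsInvertible d → d * inverse d ≈ 1#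
  inverse-right {d} inv with em {P = IsInvertible d}
  ... | yes (_ , _ , p) = p
  ... | no ¬inv = contradiction inv ¬inv

  -- The candidates h d⁻¹ with h in G - G and d a difference of `Is`. The same list gives the
  -- finiteness of `Stab e` and, through its length, the bound on |S|.
  quotients : List Carrier → List Carrier
  quotients Is = cartesianProductWith _*_ (dedup (G ⊟ G)) (map inverse (cartesianProductWith _-_ Is Is))

  stab-finite : ∀ {e r} Is → (∀ {x} → x ∈ₚ Is → x ∈ X) → AllPairs (λ x y → ¬ ¬ IsInvertible (x - y)) Is →
    pow κ e ℕ.< length Is → Stab e r → r ∈ quotients Is
  stab-finite {e} {r} Is Is⊆X pairs long p =
    let (x , y , x∈ , y∈ , inv , h∈) = stab-quotient Is Is⊆X pairs long p
        d⁻¹ = inverse (x - y)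
    in ∈-resp (trans (*-assoc r (x - y) d⁻¹) (trans (*-congˡ (inverse-right inv)) (*-identityʳ r)))
         (Membershipₚ.∈-cartesianProductWith⁺ setoid setoid setoid *-cong (dedup⁺ h∈)
           (∈ₚ⇒∈ (Propₚ.∈-map⁺ inverse (Propₚ.∈-cartesianProductWith⁺ _-_ x∈ y∈))))

  length-quotients : ∀ Is → length (quotients Is) ≡ ∥ G ⊟ G ∥ ℕ.* (length Is ℕ.* length Is)
  length-quotients Is = ≡.trans (length-cartesianProductWith _*_ (dedup (G ⊟ G)) (map inverse (cartesianProductWith _-_ Is Is)))
    (≡.cong (∥ G ⊟ G ∥ ℕ.*_) (≡.trans (length-map inverse (cartesianProductWith _-_ Is Is)) (length-cartesianProductWith _-_ Is Is)))

  -- The exponents: 224 = 2·102 + 20 for g ∈ G, 468 = 2·224 + 20 for h ∈ G − G, and 244 = 224 + 20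
  -- for the reversal at d ∈ G, so that 712 = 468 + 244; and 1444 = 2·712 + 20 suffices for closure.
  module Conjugation {b b⁻¹ : Carrier} (b⁻¹b : b⁻¹ * b ≈ 1#) (bb⁻¹ : b * b⁻¹ ≈ 1#)
    (close : ∀ {x} → x ∈ X → dilate x G ≲[ 102 ] dilate b G)
    (Is : List Carrier) (Is⊆X : ∀ {x} → x ∈ₚ Is → x ∈ X)
    (pairs : AllPairs (λ x y → ¬ ¬ IsInvertible (x - y)) Is) (long : length Is ≡ suc (pow κ 1444))
    where

    close-difference : ∀ {g} → g ∈ G → dilate g G ≲[ 224 ] dilate b G
    close-difference g∈ = let (x , y , x∈ , y∈ , e) = ⊟⁻ X X g∈ in
      ⊆-≲ (dilate-cong e) (dilate-G-difference {e = 102} {102} (close x∈) (close y∈))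

    close-difference² : ∀ {h} → h ∈ G ⊟ G → dilate h G ≲[ 468 ] dilate b G
    close-difference² h∈ = let (x , y , x∈ , y∈ , e) = ⊟⁻ G G h∈ in
      ⊆-≲ (dilate-cong e) (dilate-G-difference {e = 224} {224} (close-difference x∈) (close-difference y∈))

    conj : Carrier → Carrier
    conj r = b⁻¹ * (r * b)

    conj-injective : ∀ {r s} → conj r ≈ conj s → r ≈ s
    conj-injective {r} {s} e = trans (sym (undo r)) (trans (*-congʳ (*-cancelˡ (b , bb⁻¹ , b⁻¹b) e)) (undo s))
      where
      undo : ∀ r → (r * b) * b⁻¹ ≈ r
      undo r = trans (*-assoc r b b⁻¹) (trans (*-congˡ bb⁻¹) (*-identityʳ r))

    -- Writing r = h d⁻¹, the conjugate b⁻¹ r b is the product of b⁻¹h and d⁻¹b.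
    stab-conj : ∀ {r} → Stab 1444 r → Stab 712 (conj r)
    stab-conj {r} p =
      let (x , y , x∈ , y∈ , inv@(d⁻¹ , d⁻¹d , dd⁻¹) , h∈) =
            stab-quotient Is Is⊆X pairs (ℕ.≤-reflexive (≡.sym long)) p
          d = x - y
      in stab-resp (begin
           (b⁻¹ * (r * d)) * (d⁻¹ * b)   ≈⟨ *-assoc b⁻¹ (r * d) (d⁻¹ * b) ⟩
           b⁻¹ * ((r * d) * (d⁻¹ * b))   ≈⟨ *-congˡ (*-assoc r d (d⁻¹ * b)) ⟩
           b⁻¹ * (r * (d * (d⁻¹ * b)))   ≈⟨ *-congˡ (*-congˡ (cancel b dd⁻¹)) ⟩
           b⁻¹ * (r * b)                 ∎)
         (stab-* (stab-of b⁻¹ b⁻¹b (close-difference² h∈))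
                 (stab-of d⁻¹ d⁻¹d (reversal inv (close-difference (⊟⁺ (Is⊆X x∈) (Is⊆X y∈))))))
      where open SetoidReasoning setoid

    elements : List Carrier
    elements = dedup (select (Stab 1444) (quotients Is))

    elements⁺ : ∀ {r} → Stab 1444 r → r ∈ elements
    elements⁺ p = dedup⁺ (select⁺ {P = Stab 1444} stab-resp (stab-finite Is Is⊆X pairs (ℕ.≤-reflexive (≡.sym long)) p) p)

    elements⁻ : ∀ {r} → r ∈ elements → Stab 1444 r
    elements⁻ {r} r∈ = proj₂ (select⁻ {P = Stab 1444} stab-resp {r} {quotients Is} (dedup⁻ r∈))

    widen : ∀ {r} → Stab 712 r → Stab 1444 r
    widen = stab-weaken (ℕ.≤ᵇ⇒≤ 712 1444 tt)

    -- Conjugation is an injection of the finite set Stab 1444 into its subset Stab 712.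
    conj-surjective : ∀ {r} → Stab 1444 r → ∃[ s ] Stab 1444 s × r ≈ conj s
    conj-surjective p =
      let (s , s∈ , e) = Membershipₚ.∈-map⁻ setoid setoid (⊇-of-length image! image⊆
            (ℕ.≤-reflexive (≡.sym (length-map conj elements))) (elements⁺ p))
      in s , elements⁻ s∈ , e
      where
      image! : Unique (map conj elements)
      image! = Uniqueₚ.map⁺ setoid setoid conj-injective (dedup-unique _)
      image⊆ : map conj elements ⊆ elements
      image⊆ z∈ = let (s , s∈ , e) = Membershipₚ.∈-map⁻ setoid setoid z∈ in
        ∈-resp (sym e) (elements⁺ (widen (stab-conj (elements⁻ s∈))))

    -- Self-improvement: every element is a conjugate, and conjugates satisfy the smaller exponent.
    -- The room between 712 and 1444 then pays for one difference or one product.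
    narrow : ∀ {r} → Stab 1444 r → Stab 712 r
    narrow p = let (s , q , e) = conj-surjective p in stab-resp (sym e) (stab-conj q)

-- The structure theorem when few differences are non-invertible

module SumProduct (em : ∀ {a} → ExcludedMiddle a) (κ : ℕ) (2≤κ : 2 ℕ.≤ κ) {c ℓ} (R : Ring c ℓ) where

  open Ring R
  open RingSubsets R using (IsInvertible; IsSubring; _·ˡ_; _·ʳ_)
  open Ringₚ R using (x[y-z]≈xy-xz)
  open AbelianGroupSolver +-abelianGroup using (solveₐ; _⊕_; _⊖_)
  open Finite em
  open OnSetoid setoid
  open Sumsets em +-abelianGroup
  open Covers em κ +-abelianGroup
  open Dilates em κ R

  1≤κ : 1 ℕ.≤ κ
  1≤κ = ℕ.≤-trans (s≤s z≤n) 2≤κ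

  -- Alternative (ii) for lists, with powers of κ as bounds. Here 2910 = 20 + 2·1445 comes from |G -
  -- G| ≤ κ^20 |X| and |Is| ≤ κ^1445, and 8 = 1 + 7 from |A + X| ≤ κ|A| ≤ κ^8 |X|.
  record Structured (A : List Carrier) : Set (Level.suc (c ⊔ ℓ)) where
    field
      S           : Pred Carrier (c ⊔ ℓ)
      subring     : IsSubring S
      elements    : List Carrier
      unique      : Unique elements
      small       : length elements ℕ.≤ pow κ 2910 ℕ.* length A
      enumerates  : ∀ x → S x ⇔ x ∈ elements
      a           : Carrier
      a∈A         : a ∈ A
      invertible  : IsInvertible a
      normalises  : (a ·ˡ S) ≐ (S ·ʳ a)
      shifts      : List Carrier
      nonempty    : ∃[ y ] y ∈ shifts
      few         : length shifts ℕ.≤ pow κ 8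
      covers      : ∀ {x} → x ∈ A → ∃[ s ] ∃[ y ] S s × y ∈ shifts × x ≈ a * s + y

  module _ (A : List Carrier) (A! : Unique A) (0<A : 0 ℕ.< length A)
    (sums : ∥ A ⊞ A ∥ ℕ.≤ pow κ 1 ℕ.* length A)
    (products : ∥ cartesianProductWith _*_ A A ∥ ℕ.≤ pow κ 1 ℕ.* length A)
    (¬invertible-0 : ¬ IsInvertible 0#)
    (sparse : ∀ a → length (select (λ x → ¬ IsInvertible (x - a)) A) ℕ.* pow κ 1452 ℕ.≤ length A)
    -- 1452 = 1445 + 7: X has density at least κ⁻⁷ in A, and more than κ¹⁴⁴⁴ separated points are needed.
    where

    NonUnit : Carrier → Carrier → Set _
    NonUnit a x = ¬ IsInvertible (x - a)

    open PopularDilate em κ 2≤κ R A using (Popular; pow-suc; popular-dilate)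

    units : List Carrier
    units = select IsInvertible A

    -- A non-invertible x has x - 0 non-invertible, so `sparse` at `0#` leaves at most half of A
    -- outside the units, and κ ≥ 2.
    few-nonunits : length A ℕ.≤ pow κ 1 ℕ.* length units
    few-nonunits = begin
      length A                            ≡⟨ length-select+reject IsInvertible A ⟩
      length units ℕ.+ length nonunits    ≤⟨ ℕ.+-monoʳ-≤ (length units) nonunits≤ ⟩
      length units ℕ.+ length units       ≡⟨ ≡.cong (length units ℕ.+_) (ℕ.+-identityʳ (length units)) ⟨
      2 ℕ.* length units                  ≤⟨ ℕ.*-monoˡ-≤ (length units) (ℕ.≤-trans 2≤κ (ℕ.≤-reflexive (≡.sym (pow-1 κ)))) ⟩
      pow κ 1 ℕ.* length units            ∎
      where
      open ℕ.≤-Reasoning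
      nonunits = reject IsInvertible A
      N = length nonunits
      sub : nonunits ⊆ select (NonUnit 0#) A
      sub {x} x∈ with reject⁻ {P = IsInvertible} invertible-resp {x} {A} x∈
      ... | x∈A , ¬inv = select⁺ {P = NonUnit 0#} (λ e n i → n (invertible-resp (-‿cong₂ (sym e) refl) i)) x∈A
        λ i → ¬inv (invertible-resp (x-0≈x x) i)
      nonunits≤ : N ℕ.≤ length units
      nonunits≤ = ℕ.+-cancelʳ-≤ N N (length units) (begin
        N ℕ.+ N                             ≡⟨ ≡.cong (N ℕ.+_) (ℕ.+-identityʳ N) ⟨
        2 ℕ.* N                             ≡⟨ ℕ.*-comm 2 N ⟩
        N ℕ.* 2                             ≤⟨ ℕ.*-mono-≤ (length-mono (Uniqueₚ.filter⁺ setoid (¬? ∘ decide IsInvertible) A!) sub)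
                                                 (ℕ.≤-trans 2≤κ (ℕ.≤-trans (ℕ.≤-reflexive (≡.sym (pow-1 κ))) (pow-mono κ 1≤κ (ℕ.≤ᵇ⇒≤ 1 1452 tt)))) ⟩
        length (select (NonUnit 0#) A) ℕ.* pow κ 1452 ≤⟨ sparse 0# ⟩
        length A                            ≡⟨ length-select+reject IsInvertible A ⟩
        length units ℕ.+ N                  ∎)

    0<-from : ∀ {e} (xs : List Carrier) → length A ℕ.≤ pow κ e ℕ.* length xs → 0 ℕ.< length xs
    0<-from {e} xs le = ℕ.n≢0⇒n>0 λ eq → ℕ.<⇒≱ 0<A
      (ℕ.≤-trans le (ℕ.≤-reflexive (≡.trans (≡.cong (pow κ e ℕ.*_) eq) (ℕ.*-zeroʳ (pow κ e)))))

    -- The double negation is what `greedy` returns for `NonUnit`, which is itself a negation.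
    Separated : List Carrier → List Carrier → Set (c ⊔ ℓ)
    Separated X Is = (∀ {x} → x ∈ₚ Is → x ∈ X) × AllPairs (λ x y → ¬ ¬ IsInvertible (x - y)) Is
      × length Is ≡ suc (pow κ 1444)

    -- Take a greedy net for `NonUnit`. Each of its points accounts for at most |A|/κ^1452 elements
    -- of X, and |X| ≥ |A|/κ^7, so the net has at least κ^1445 ≥ κ^1444 + 1 points and can be
    -- truncated.
    separated : ∀ X → Unique X → X ⊆ A → length A ℕ.≤ pow κ 7 ℕ.* length X →
      ∃[ Is ] Separated X Is
    separated X X! X⊆A A≤ = extract (greedy (λ x y → NonUnit y x) (λ x i → ¬invertible-0 (invertible-resp (-‿inverseʳ x) i)) X)
      where
      0<X = 0<-from X A≤
      extract : (∃[ ys ] (∀ {y} → y ∈ₚ ys → y ∈ₚ X) × AllPairs (λ x y → ¬ NonUnit y x) ys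
                  × (∀ {x} → x ∈ₚ X → ∃[ y ] y ∈ₚ ys × NonUnit y x)) →
                ∃[ Is ] Separated X Is
      extract (ys , ys⊆ , pairs , cov) = take t ys , ∈ₚ⇒∈ ∘ ys⊆ ∘ ∈-take⁻ t ys , AllPairsₚ.take⁺ t pairs
        , ≡.trans (length-take t ys) (ℕ.m≤n⇒m⊓n≡m (ℕ.≤-trans t≤ many))
        where
        open ℕ.≤-Reasoning
        t = suc (pow κ 1444)
        t≤ : t ℕ.≤ pow κ 1445
        t≤ = ℕ.≤-trans (ℕ.+-monoˡ-≤ (pow κ 1444) (pow-pos κ 1444 1≤κ))
          (ℕ.≤-trans (ℕ.≤-reflexive (≡.cong (pow κ 1444 ℕ.+_) (≡.sym (ℕ.+-identityʳ (pow κ 1444))))) (pow-suc 1444))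
        many : pow κ 1445 ℕ.≤ length ys
        many =
          let (y , y∈ , le) = pigeonhole (λ x y → NonUnit y x) X ys (proj₂ (first 0<X)) cov
              f = length (select (NonUnit y) X)
              g = length (select (NonUnit y) A)
              resp : ∀ {u v} → u ≈ v → NonUnit y u → NonUnit y v
              resp = λ e n i → n (invertible-resp (-‿cong₂ (sym e) refl) i)
              f≤g = length-mono (Uniqueₚ.filter⁺ setoid (decide (NonUnit y)) X!)
                λ {z} z∈ → let (p , q) = select⁻ {P = NonUnit y} resp {z} {X} z∈ in select⁺ {P = NonUnit y} resp (X⊆A p) q
          in ℕ.*-cancelʳ-≤ (pow κ 1445) (length ys) (pow κ 7 ℕ.* length X)
               {{ℕ.>-nonZero (ℕ.*-mono-≤ (pow-pos κ 7 1≤κ) 0<X)}} (begin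
            pow κ 1445 ℕ.* (pow κ 7 ℕ.* length X)       ≡⟨ ℕ.*-assoc (pow κ 1445) (pow κ 7) (length X) ⟨
            pow κ 1445 ℕ.* pow κ 7 ℕ.* length X         ≡⟨ ≡.cong (ℕ._* length X) (pow-+ κ 1445 7) ⟩
            pow κ 1452 ℕ.* length X                     ≡⟨ ℕ.*-comm (pow κ 1452) (length X) ⟩
            length X ℕ.* pow κ 1452                     ≤⟨ ℕ.*-monoˡ-≤ (pow κ 1452) (ℕ.≤-trans le (ℕ.*-monoʳ-≤ (length ys) f≤g)) ⟩
            length ys ℕ.* g ℕ.* pow κ 1452              ≡⟨ ℕ.*-assoc (length ys) g (pow κ 1452) ⟩
            length ys ℕ.* (g ℕ.* pow κ 1452)            ≤⟨ ℕ.*-monoʳ-≤ (length ys) (sparse y) ⟩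
            length ys ℕ.* length A                      ≤⟨ ℕ.*-monoʳ-≤ (length ys) A≤ ⟩
            length ys ℕ.* (pow κ 7 ℕ.* length X)        ∎)

    module _ {b : Carrier} (b∈A : b ∈ A) (b-inv : IsInvertible b)
      (X : List Carrier) (X! : Unique X) (X⊆A : X ⊆ A) (A≤ : length A ℕ.≤ pow κ 7 ℕ.* length X)
      (differences : SmallDifferences 20 X)
      (near : ∀ {x} → x ∈ X → dilate x A ≲[ 5 ] dilate b (A ⊟ A))
      (Is : List Carrier) (Is⊆X : ∀ {x} → x ∈ₚ Is → x ∈ X)
      (pairs : AllPairs (λ x y → ¬ ¬ IsInvertible (x - y)) Is) (long : length Is ≡ suc (pow κ 1444))
      where

      open Stabiliser em κ 1≤κ R X X! (0<-from X A≤) differences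

      private
        b⁻¹ = proj₁ b-inv
        b⁻¹b = proj₁ (proj₂ b-inv)
        bb⁻¹ = proj₂ (proj₂ b-inv)

      ∥A⊞X∥≤ : ∥ A ⊞ X ∥ ℕ.≤ pow κ 8 ℕ.* length X
      ∥A⊞X∥≤ = pow-*-≤ κ 1 7 (ℕ.≤-trans (∥∥-mono (⊞-mono {A} {V = X} id X⊆A)) sums) A≤

      A≲G : A ≲[ 8 ] G
      A≲G = covering-≲ 8 X! x₀∈ ∥A⊞X∥≤

      A⊟A≲G : A ⊟ A ≲[ 36 ] G
      A⊟A≲G = ≲-trans (≲-⊟ A≲G A≲G) G⊟G≲G

      -- xG lies in xA - xA. Each xA is covered by translates of b(A - A) at exponent 5 and A - A by
      -- translates of G at exponent 36, which makes 41; then 102 = 41 + 41 + 20.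
      close : ∀ {x} → x ∈ X → dilate x G ≲[ 102 ] dilate b G
      close {x} x∈ = ⊆-≲ (⊟-mono (dilate-mono X⊆A) (dilate-mono X⊆A) ∘ dilate-⊟⇒ x X X)
        (≲-trans (≲-⊆ (≲-⊟ xA xA) (dilate-⊟⇐ b G G)) (dilate-≲ b G⊟G≲G))
        where
        xA : dilate x A ≲[ 41 ] dilate b G
        xA = ≲-trans (near x∈) (dilate-≲ b A⊟A≲G)

      open Conjugation b⁻¹b bb⁻¹ close Is Is⊆X pairs long

      S : Pred Carrier (c ⊔ ℓ)
      S = Stab 1444

      S-difference : ∀ {x y} → S x → S y → S (x - y)
      S-difference p q = stab-difference (narrow p) (narrow q)

      0∈S : S 0#
      0∈S = stab-weaken z≤n stab-0

      S-subring : IsSubring S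
      S-subring = record
        { resp       = stab-resp
        ; 0#-mem     = 0∈S
        ; +-closed   = λ {x} {y} p q → stab-resp (trans (solveₐ (v₀ ⊖ (v₂ ⊖ v₁)) (v₀ ⊕ v₁ ⊖ v₂) ≡.refl (x ∷ y ∷ 0# ∷ []))
                         (trans (+-assoc x y _) (+-congˡ (x-0≈x y)))) (S-difference p (S-difference 0∈S q))
        ; neg-closed = λ p → stab-resp (+-identityˡ _) (S-difference 0∈S p)
        ; *-closed   = λ p q → stab-weaken (ℕ.≤ᵇ⇒≤ 1424 1444 tt) (stab-* (narrow p) (narrow q))
        }

      elements-small : length elements ℕ.≤ pow κ 2910 ℕ.* length A
      elements-small = begin
        length elements
          ≤⟨ length-mono (dedup-unique _) (λ {r} r∈ → proj₁ (select⁻ {P = S} stab-resp {r} {quotients Is} (dedup⁻ r∈))) ⟩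
        length (quotients Is)
          ≡⟨ length-quotients Is ⟩
        ∥ G ⊟ G ∥ ℕ.* (length Is ℕ.* length Is)
          ≤⟨ ℕ.*-mono-≤ ∥G⊟G∥≤ (ℕ.*-mono-≤ Is≤ Is≤) ⟩
        pow κ 20 ℕ.* length X ℕ.* (pow κ 1445 ℕ.* pow κ 1445)
          ≡⟨ ≡.cong (pow κ 20 ℕ.* length X ℕ.*_) (pow-+ κ 1445 1445) ⟩
        pow κ 20 ℕ.* length X ℕ.* pow κ 2890
          ≡⟨ ≡.trans (ℕ.*-comm (pow κ 20 ℕ.* length X) (pow κ 2890)) (≡.sym (ℕ.*-assoc (pow κ 2890) (pow κ 20) (length X))) ⟩
        pow κ 2890 ℕ.* pow κ 20 ℕ.* length X
          ≡⟨ ≡.cong (ℕ._* length X) (pow-+ κ 2890 20) ⟩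
        pow κ 2910 ℕ.* length X
          ≤⟨ ℕ.*-monoʳ-≤ (pow κ 2910) (length-mono X! X⊆A) ⟩
        pow κ 2910 ℕ.* length A ∎
        where
        open ℕ.≤-Reasoning
        Is≤ : length Is ℕ.≤ pow κ 1445
        Is≤ = ℕ.≤-trans (ℕ.≤-reflexive long) (ℕ.≤-trans (ℕ.+-monoˡ-≤ (pow κ 1444) (pow-pos κ 1444 1≤κ))
          (ℕ.≤-trans (ℕ.≤-reflexive (≡.cong (pow κ 1444 ℕ.+_) (≡.sym (ℕ.+-identityʳ (pow κ 1444))))) (pow-suc 1444)))

      b-conj : ∀ s → b * conj s ≈ s * b
      b-conj s = cancel (s * b) bb⁻¹

      CosetCover : List Carrier → Set (c ⊔ ℓ)
      CosetCover Y = (∀ {y} → y ∈ₚ Y → y ∈ₚ A) × length Y ℕ.* length X ℕ.≤ ∥ A ⊞ X ∥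
        × (∀ {x} → x ∈ₚ A → ∃[ y ] y ∈ₚ Y × S (b⁻¹ * (x - y)))

      -- Ruzsa covering with "same coset of bS" as the relation: if i + x = j + y with x, y in X,
      -- then b⁻¹(i - j) = b⁻¹y - b⁻¹x, and b⁻¹X lies in S.
      cosets : ∃[ Y ] CosetCover Y
      cosets = covering (λ a → map (a +_) X) (λ x y → S (b⁻¹ * (x - y)))
        (λ x → stab-resp (sym (trans (*-congˡ (-‿inverseʳ x)) (zeroʳ b⁻¹))) 0∈S) meet (length X) (A ⊞ X) A
        λ {u} u∈ → translate-unique u X! , ℕ.≤-reflexive (≡.sym (length-map (u +_) X)) , translate-⊆ (∈ₚ⇒∈ u∈)
        where
        in-S : ∀ {x} → x ∈ X → Stab 102 (b⁻¹ * x)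
        in-S x∈ = stab-of b⁻¹ b⁻¹b (close x∈)
        meet : ∀ {i j z} → z ∈ map (i +_) X → z ∈ map (j +_) X → S (b⁻¹ * (i - j))
        meet {i} {j} p q =
          let (x , x∈ , e) = translate⁻ i p
              (y , y∈ , f) = translate⁻ j q
          in stab-resp (begin
               b⁻¹ * y - b⁻¹ * x            ≈⟨ x[y-z]≈xy-xz b⁻¹ y x ⟨
               b⁻¹ * (y - x)                ≈⟨ *-congˡ (solveₐ (v₁ ⊖ v₀) (v₂ ⊕ v₁ ⊖ v₀ ⊖ v₂) ≡.refl (x ∷ y ∷ j ∷ [])) ⟩
               b⁻¹ * (j + y - x - j)        ≈⟨ *-congˡ (+-congʳ (+-congʳ (trans (sym f) e))) ⟩
               b⁻¹ * (i + x - x - j)        ≈⟨ *-congˡ (solveₐ (v₁ ⊕ v₀ ⊖ v₀ ⊖ v₂) (v₁ ⊖ v₂) ≡.refl (x ∷ i ∷ j ∷ [])) ⟩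
               b⁻¹ * (i - j)                ∎)
             (stab-weaken (ℕ.≤ᵇ⇒≤ 224 1444 tt) (stab-difference (in-S y∈) (in-S x∈)))
          where open SetoidReasoning setoid

      -- Since b · conj t = t · b, one inclusion is surjectivity of conjugation on S and the other
      -- its invariance of S.
      normalised : (b ·ˡ S) ≐ (S ·ʳ b)
      normalised = left , right
        where
        swap : ∀ {x s} → x ≈ b * s → ∃[ t ] S t × s ≈ conj t → (S ·ʳ b) x
        swap e (t , q , f) = t , q , trans e (trans (*-congˡ f) (b-conj t))
        left : ∀ {x} → (b ·ˡ S) x → (S ·ʳ b) x
        left (s , p , e) = swap e (conj-surjective {s} p)
        right : ∀ {x} → (S ·ʳ b) x → (b ·ˡ S) x
        right (s , p , e) = conj s , widen {conj s} (stab-conj {s} p) , trans e (sym (b-conj s))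

      module _ (Y : List Carrier) (cosetCover : CosetCover Y) where

        Y-nonempty : ∃[ y ] y ∈ Y
        Y-nonempty = let (a , a∈ , _) = find b∈A
                         (y , y∈ , _) = proj₂ (proj₂ cosetCover) a∈
                     in y , ∈ₚ⇒∈ y∈

        Y-few : length Y ℕ.≤ pow κ 8
        Y-few = ℕ.*-cancelʳ-≤ (length Y) (pow κ 8) (length X) {{ℕ.>-nonZero (0<-from X A≤)}}
          (ℕ.≤-trans (proj₁ (proj₂ cosetCover)) ∥A⊞X∥≤)

        Y-covers : ∀ {x} → x ∈ A → ∃[ s ] ∃[ y ] S s × y ∈ Y × x ≈ b * s + y
        Y-covers x∈ =
          let (x′ , x′∈ , e) = find x∈
              (y , y∈ , p) = proj₂ (proj₂ cosetCover) x′∈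
          in b⁻¹ * (x′ - y) , y , p , ∈ₚ⇒∈ y∈
             , trans e (trans (solveₐ v₀ (v₀ ⊖ v₁ ⊕ v₁) ≡.refl (x′ ∷ y ∷ [])) (+-congʳ (sym (cancel (x′ - y) bb⁻¹))))

        conclusion : Structured A
        conclusion = record
          { S = S
          ; subring = S-subring
          ; elements = elements
          ; unique = dedup-unique (select S (quotients Is))
          ; small = elements-small
          ; enumerates = λ x → mk⇔ elements⁺ elements⁻
          ; a = b
          ; a∈A = b∈A
          ; invertible = b-inv
          ; normalises = normalised
          ; shifts = Y
          ; nonempty = Y-nonempty
          ; few = Y-few
          ; covers = Y-covers
          }

    -- Densities multiply: units cost κ and popularity κ², so |A| ≤ κ³|B| and B has doubling κ⁴.
    -- Petridis's lemma costs another κ⁴, so |A| ≤ κ⁷|X|, and the differences of X have exponent 5·4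
    -- = 20.
    structure : Structured A
    structure = from-popular (popular-dilate A! 0<A products units unit⁻ (proj₂ (first (0<-from units few-nonunits))))
      where
      unit⁻ : ∀ {x} → x ∈ₚ units → x ∈ₚ A × IsInvertible x
      unit⁻ = Propₚ.∈-filter⁻ (decide IsInvertible)
      from-popular : (∃[ b ] b ∈ₚ units × length units ℕ.≤ pow κ 2 ℕ.* length (fibre Popular b units)) → Structured A
      from-popular (b , b∈ , le) = from-doubling (small-doubling 4 B B! (0<-from B A≤B) doubling)
        where
        B = fibre Popular b units
        A≤B : length A ℕ.≤ pow κ 3 ℕ.* length B
        A≤B = pow-*-≤ κ 1 2 few-nonunits le
        B! : Unique B
        B! = Uniqueₚ.filter⁺ setoid (decide (λ x → Popular x b)) (Uniqueₚ.filter⁺ setoid (decide IsInvertible) A!)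
        B⁻ : ∀ {x} → x ∈ₚ B → (x ∈ₚ A × IsInvertible x) × Popular x b
        B⁻ x∈ = let (p , q) = Propₚ.∈-filter⁻ (decide (λ x → Popular x b)) {xs = units} x∈ in unit⁻ p , q
        B⊆A : B ⊆ A
        B⊆A x∈ = let (x′ , x′∈ , e) = find x∈ in ∈-resp (sym e) (∈ₚ⇒∈ (proj₁ (proj₁ (B⁻ x′∈))))
        doubling : ∥ B ⊞ B ∥ ℕ.≤ pow κ 4 ℕ.* length B
        doubling = pow-*-≤ κ 1 3 (ℕ.≤-trans (∥∥-mono (⊞-mono {B} {V = B} B⊆A B⊆A)) sums) A≤B
        near : ∀ {x} → x ∈ B → dilate x A ≲[ 5 ] dilate b (A ⊟ A)
        near x∈ = let (x′ , x′∈ , e) = find x∈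
                      ((_ , inv) , popular) = B⁻ x′∈
                  in ⊆-≲ (dilate-cong e) (common⇒≲ 4 inv A! 0<A 1 sums popular)
        from-doubling : (∃[ X ] IsCore 4 B X) → Structured A
        from-doubling (X , X⊆B , X! , _ , B≤X , differences) =
          let A≤X = pow-*-≤ κ 3 4 A≤B B≤X
              (Is , Is⊆X , pairs , long) = separated X X! (B⊆A ∘ X⊆B) A≤X
              (Y , cosetCover) = cosets (∈ₚ⇒∈ (proj₁ (unit⁻ b∈))) (proj₂ (unit⁻ b∈)) X X! (B⊆A ∘ X⊆B) A≤X differences (near ∘ X⊆B)
                Is Is⊆X pairs long
          in conclusion (∈ₚ⇒∈ (proj₁ (unit⁻ b∈))) (proj₂ (unit⁻ b∈)) X X! (B⊆A ∘ X⊆B) A≤X differences (near ∘ X⊆B)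
               Is Is⊆X pairs long Y cosetCover

-- Products of division rings

module ProductRing (em : ∀ {a} → ExcludedMiddle a) {c ℓ} {k : ℕ} (D : Fin k → DivisionRing c ℓ) where

  open Product D using (module D; productRing)
  open Ring productRing
  open RingSubsets productRing using (IsInvertible)
  open Finite em
  open OnSetoid setoid
  open Sumsets em +-abelianGroup
  module Coordinate j = OnSetoid (D.setoid j)

  _≈⟨_⟩_ : Carrier → Fin k → Carrier → Set ℓ
  x ≈⟨ j ⟩ y = D._≈_ j (x j) (y j)


  -- If no coordinate vanished, the inverses in the division rings would assemble to an inverse in
  -- the product.
  nonunit⇒zero-coordinate : ∀ {x} → ¬ IsInvertible x → ∃[ j ] x ≈⟨ j ⟩ 0#
  nonunit⇒zero-coordinate {x} ¬inv = decidable-stable em λ none →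
    let inverse = λ i → DivisionRing.inverse (D i) (x i) (λ e → none (i , e))
    in ¬inv ((λ i → proj₁ (inverse i)) , (λ i → proj₁ (proj₂ (inverse i))) , (λ i → proj₂ (proj₂ (inverse i))))

  ¬invertible-0 : Fin k → ¬ IsInvertible 0#
  ¬invertible-0 j (i , _ , p) = DivisionRing.0≉1 (D j) (D.trans j (D.sym j (D.zeroˡ j (i j))) (p j))

  -- All points of x + L have j-th coordinate x_j + t, so translates for different values of x_j are
  -- disjoint subsets of the sumset.
  fibre-bound : ∀ j xs L t → Unique L → L ⊆ xs → (∀ {l} → l ∈ L → D._≈_ j (l j) t) →
    Coordinate.∥_∥ j (map (λ x → x j) xs) ℕ.* length L ℕ.≤ ∥ xs ⊞ xs ∥
  fibre-bound j xs L t L! L⊆ constant = finish (covering (λ x → map (x +_) L) (λ x y → x ≈⟨ j ⟩ y) (λ x → D.refl j) meet (length L)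
      (xs ⊞ xs) xs λ {x} x∈ → translate-unique x L! , ℕ.≤-reflexive (≡.sym (length-map (x +_) L))
        , λ z∈ → ⊞-mono {xs} {V = L} id L⊆ (translate-⊆ (∈ₚ⇒∈ x∈) z∈))
    where
    meet : ∀ {x y z} → z ∈ map (x +_) L → z ∈ map (y +_) L → x ≈⟨ j ⟩ y
    meet {x} {y} p q =
      let (l , l∈ , e) = translate⁻ x p
          (l′ , l′∈ , f) = translate⁻ y q
      in +-cancelʳ t (x j) (y j)
           (D.trans j (D.+-cong j (D.refl j) (D.sym j (constant l∈))) (D.trans j (D.sym j (e j))
             (D.trans j (f j) (D.+-cong j (D.refl j) (constant l′∈)))))
      where open Ringₚ (DivisionRing.ring (D j)) using (+-cancelʳ)
    finish : (∃[ Y ] (∀ {y} → y ∈ₚ Y → y ∈ₚ xs) × length Y ℕ.* length L ℕ.≤ ∥ xs ⊞ xs ∥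
               × (∀ {x} → x ∈ₚ xs → ∃[ y ] y ∈ₚ Y × x ≈⟨ j ⟩ y)) →
             Coordinate.∥_∥ j (map (λ x → x j) xs) ℕ.* length L ℕ.≤ ∥ xs ⊞ xs ∥
    finish (Y , _ , le , cov) = ℕ.≤-trans (ℕ.*-monoˡ-≤ (length L) (ℕ.≤-trans (Coordinate.∥∥≤ j sub)
        (ℕ.≤-reflexive (length-map (λ x → x j) Y)))) le
      where
      sub : Coordinate._⊆_ j (map (λ x → x j) xs) (map (λ x → x j) Y)
      sub z∈ =
        let (x , x∈ , e) = Membershipₚ.∈-map⁻ setoid (D.setoid j) z∈
            (x′ , x′∈ , f) = find x∈
            (y , y∈ , g) = cov x′∈
        in Coordinate.∈-resp j (D.sym j (D.trans j e (D.trans j (f j) g))) (Coordinate.∈ₚ⇒∈ j (Propₚ.∈-map⁺ (λ x → x j) y∈))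

  module _ (κ : ℕ) (1≤κ : 1 ℕ.≤ κ) (xs : List Carrier) (xs! : Unique xs)
    (sums : ∥ xs ⊞ xs ∥ ℕ.≤ pow κ 1 ℕ.* length xs)
    (large : ∀ j → k ℕ.* pow κ 1453 ℕ.≤ Coordinate.∥_∥ j (map (λ x → x j) xs)) where

    -- Each counted x agrees with a in some coordinate; by pigeonhole one coordinate j takes a share
    -- 1/k of them, and `fibre-bound` with |π_j| ≥ k κ^1453 bounds that share. One factor κ of
    -- κ^1453 is spent on |A + A| ≤ κ|A|.
    sparse : ∀ a → length (select (λ x → ¬ IsInvertible (x - a)) xs) ℕ.* pow κ 1452 ℕ.≤ length xs
    sparse a = bound (select NonUnit xs) ≡.refl
      where
      NonUnit : Carrier → Set _
      NonUnit x = ¬ IsInvertible (x - a)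
      bound : ∀ L → L ≡ select NonUnit xs → length L ℕ.* pow κ 1452 ℕ.≤ length xs
      bound [] _ = z≤n
      bound L@(l₀ ∷ _) L≡ = finish (pigeonhole (λ x j → x ≈⟨ j ⟩ a) L (allFin k) (here ≡.refl) classify)
        where
        L! : Unique L
        L! = ≡.subst Unique (≡.sym L≡) (Uniqueₚ.filter⁺ setoid (decide NonUnit) xs!)
        L⁻ : ∀ {x} → x ∈ₚ L → x ∈ₚ xs × NonUnit x
        L⁻ {x} x∈ = Propₚ.∈-filter⁻ (decide NonUnit) {xs = xs} (≡.subst (x ∈ₚ_) L≡ x∈)
        classify : ∀ {x} → x ∈ₚ L → ∃[ j ] j ∈ₚ allFin k × x ≈⟨ j ⟩ a
        classify {x} x∈ = let (j , e) = nonunit⇒zero-coordinate (proj₂ (L⁻ x∈)) in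
          j , Propₚ.∈-allFin j , Groupₚ.x∙y⁻¹≈ε⇒x≈y (Ring.+-group (DivisionRing.ring (D j))) (x j) (a j) e
        finish : (∃[ j ] j ∈ₚ allFin k × length L ℕ.≤ length (allFin k) ℕ.* length (fibre (λ x j → x ≈⟨ j ⟩ a) j L)) →
          length L ℕ.* pow κ 1452 ℕ.≤ length xs
        finish (j , _ , le) = ℕ.*-cancelʳ-≤ (length L ℕ.* pow κ 1452) (length xs) (pow κ 1) {{ℕ.>-nonZero (pow-pos κ 1 1≤κ)}} (begin
          length L ℕ.* pow κ 1452 ℕ.* pow κ 1         ≡⟨ ℕ.*-assoc (length L) (pow κ 1452) (pow κ 1) ⟩
          length L ℕ.* (pow κ 1452 ℕ.* pow κ 1)       ≡⟨ ≡.cong (length L ℕ.*_) (pow-+ κ 1452 1) ⟩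
          length L ℕ.* pow κ 1453                     ≤⟨ ℕ.*-monoˡ-≤ (pow κ 1453) le ⟩
          length (allFin k) ℕ.* f ℕ.* pow κ 1453      ≡⟨ ≡.cong (λ z → z ℕ.* f ℕ.* pow κ 1453) (length-tabulate {n = k} id) ⟩
          k ℕ.* f ℕ.* pow κ 1453                      ≡⟨ ≡.trans (ℕ.*-assoc k f (pow κ 1453)) (≡.trans (≡.cong (k ℕ.*_) (ℕ.*-comm f (pow κ 1453)))
                                                           (≡.sym (ℕ.*-assoc k (pow κ 1453) f))) ⟩
          k ℕ.* pow κ 1453 ℕ.* f                      ≤⟨ ℕ.*-monoˡ-≤ f (large j) ⟩
          Coordinate.∥_∥ j (map (λ x → x j) xs) ℕ.* f ≤⟨ fibre-bound j xs F (a j) F! (λ z∈ → let (z′ , z′∈ , e) = find z∈ in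
                                                            ∈-resp (sym e) (∈ₚ⇒∈ (proj₁ (L⁻ (proj₁ (F⁻ z′∈))))))
                                                           (λ z∈ → let (z′ , z′∈ , e) = find z∈ in D.trans j (e j) (proj₂ (F⁻ z′∈))) ⟩
          ∥ xs ⊞ xs ∥                                 ≤⟨ sums ⟩
          pow κ 1 ℕ.* length xs                       ≡⟨ ℕ.*-comm (pow κ 1) (length xs) ⟩
          length xs ℕ.* pow κ 1                       ∎)
          where
          open ℕ.≤-Reasoning
          F = fibre (λ x j → x ≈⟨ j ⟩ a) j L
          f = length F
          F! : Unique F
          F! = Uniqueₚ.filter⁺ setoid (decide (λ x → x ≈⟨ j ⟩ a)) L!
          F⁻ : ∀ {z} → z ∈ₚ F → z ∈ₚ L × z ≈⟨ j ⟩ a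
          F⁻ = Propₚ.∈-filter⁻ (decide (λ x → x ≈⟨ j ⟩ a)) {xs = L}

-- Passage from K to an integer

open import Data.Rational as ℚ using (ℚ; 1ℚ; 0ℚ; mkℚ; _≤_; _*_; _+_; toℚᵘ; nonNegative)
import Data.Rational.Properties as ℚ
open import Data.Rational.Unnormalised as ℚᵘ using (mkℚᵘ)
import Data.Rational.Unnormalised.Properties as ℚᵘ
open import Relation.Unary using (_∈_; _⊆_; Satisfiable)

fromℕ-toℚᵘ : ∀ m → toℚᵘ (fromℕ m) ℚᵘ.≃ mkℚᵘ (ℤ.+ m) 0
fromℕ-toℚᵘ m = ℚ.toℚᵘ-fromℚᵘ (mkℚᵘ (ℤ.+ m) 0)

fromℕ-* : ∀ m n → fromℕ (m ℕ.* n) ≡ fromℕ m * fromℕ n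
fromℕ-* m n = ℚ.toℚᵘ-injective (begin
  toℚᵘ (fromℕ (m ℕ.* n))                   ≈⟨ fromℕ-toℚᵘ (m ℕ.* n) ⟩
  mkℚᵘ (ℤ.+ (m ℕ.* n)) 0                   ≈⟨ ℚᵘ.*≡* (≡.cong (ℤ._* ℤ.+ 1) (ℤ.pos-* m n)) ⟩
  mkℚᵘ (ℤ.+ m) 0 ℚᵘ.* mkℚᵘ (ℤ.+ n) 0       ≈⟨ ℚᵘ.*-cong (fromℕ-toℚᵘ m) (fromℕ-toℚᵘ n) ⟨
  toℚᵘ (fromℕ m) ℚᵘ.* toℚᵘ (fromℕ n)       ≈⟨ ℚ.toℚᵘ-homo-* (fromℕ m) (fromℕ n) ⟨
  toℚᵘ (fromℕ m * fromℕ n)                 ∎)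
  where open import Relation.Binary.Reasoning.Setoid ℚᵘ.≃-setoid

fromℕ-suc : ∀ m → fromℕ (suc m) ≡ 1ℚ + fromℕ m
fromℕ-suc m = ℚ.toℚᵘ-injective (begin
  toℚᵘ (fromℕ (suc m))                     ≈⟨ fromℕ-toℚᵘ (suc m) ⟩
  mkℚᵘ (ℤ.+ suc m) 0                       ≈⟨ ℚᵘ.*≡* (≡.cong (ℤ._* ℤ.+ 1) (≡.cong (λ z → ℤ.+ 1 ℤ.+ z) (≡.sym (ℤ.*-identityʳ (ℤ.+ m))))) ⟩
  toℚᵘ 1ℚ ℚᵘ.+ mkℚᵘ (ℤ.+ m) 0              ≈⟨ ℚᵘ.+-congʳ (toℚᵘ 1ℚ) (fromℕ-toℚᵘ m) ⟨
  toℚᵘ 1ℚ ℚᵘ.+ toℚᵘ (fromℕ m)              ≈⟨ ℚ.toℚᵘ-homo-+ 1ℚ (fromℕ m) ⟨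
  toℚᵘ (1ℚ + fromℕ m)                      ∎)
  where open import Relation.Binary.Reasoning.Setoid ℚᵘ.≃-setoid

fromℕ-mono : ∀ {m n} → m ℕ.≤ n → fromℕ m ≤ fromℕ n
fromℕ-mono {m} {n} m≤n = ℚ.toℚᵘ-cancel-≤
  (ℚᵘ.≤-respˡ-≃ (ℚᵘ.≃-sym (fromℕ-toℚᵘ m)) (ℚᵘ.≤-respʳ-≃ (ℚᵘ.≃-sym (fromℕ-toℚᵘ n))
    (ℚᵘ.*≤* (ℤ.*-monoʳ-≤-nonNeg (ℤ.+ 1) (ℤ.+≤+ m≤n)))))

fromℕ-cancel : ∀ {m n} → fromℕ m ≤ fromℕ n → m ℕ.≤ n
fromℕ-cancel {m} {n} le with ℚᵘ.≤-respˡ-≃ (fromℕ-toℚᵘ m) (ℚᵘ.≤-respʳ-≃ (fromℕ-toℚᵘ n) (ℚ.toℚᵘ-mono-≤ le))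
... | ℚᵘ.*≤* p = ℤ.drop‿+≤+ (≡.subst₂ ℤ._≤_ (ℤ.*-identityʳ (ℤ.+ m)) (ℤ.*-identityʳ (ℤ.+ n)) p)

0≤fromℕ : ∀ m → 0ℚ ≤ fromℕ m
0≤fromℕ m = fromℕ-mono {0} {m} z≤n

*-mono-≤ : ∀ {p q r s} → 0ℚ ≤ r → 0ℚ ≤ q → p ≤ q → r ≤ s → p * r ≤ q * s
*-mono-≤ {p} {q} {r} 0≤r 0≤q p≤q r≤s = ℚ.≤-trans (ℚ.*-monoʳ-≤-nonNeg r {{ℚ.nonNegative 0≤r}} p≤q)
  (ℚ.*-monoˡ-≤-nonNeg q {{ℚ.nonNegative 0≤q}} r≤s)

archimedean : ∀ K → ∃[ N ] K ≤ fromℕ N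
archimedean K@(mkℚ (ℤ.+ n) d c) = n , ℚ.toℚᵘ-cancel-≤ (ℚᵘ.≤-respʳ-≃ (ℚᵘ.≃-sym (fromℕ-toℚᵘ n))
  (ℚᵘ.*≤* (≡.subst₂ ℤ._≤_ (ℤ.pos-* n 1) (ℤ.pos-* n (suc d)) (ℤ.+≤+ (ℕ.*-monoʳ-≤ n (s≤s z≤n))))))
archimedean K@(mkℚ ℤ.-[1+ n ] d c) = 0 , ℚ.*≤* ℤ.-≤+

module _ {K : ℚ} (1≤K : 1ℚ ≤ K) where

  private
    0≤1 : 0ℚ ≤ 1ℚ
    0≤1 = 0≤fromℕ 1

    0≤K : 0ℚ ≤ K
    0≤K = ℚ.≤-trans 0≤1 1≤K

  ceiling : ∀ N → K ≤ fromℕ N → ∃[ m ] K ≤ fromℕ m × fromℕ m ≤ 1ℚ + K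
  ceiling zero le = 0 , le , ℚ.≤-trans 0≤K (≡.subst (_≤ 1ℚ + K) (ℚ.+-identityˡ K) (ℚ.+-monoˡ-≤ K 0≤1))
  ceiling (suc N) le with K ℚ.≤? fromℕ N
  ... | yes le′ = ceiling N le′
  ... | no N<K = suc N , le , ≡.subst (_≤ 1ℚ + K) (≡.sym (fromℕ-suc N)) (ℚ.+-monoʳ-≤ 1ℚ (ℚ.<⇒≤ (ℚ.≰⇒> N<K)))

  -- κ is one more than some m with K ≤ m ≤ K + 1. The successor secures κ ≥ 2 even for K = 1, and κ
  -- ≤ K + 2 ≤ 3K because K ≥ 1.
  natural-bound : ∃[ κ ] K ≤ fromℕ κ × 2 ℕ.≤ κ × fromℕ κ ≤ fromℕ 3 * K
  natural-bound =
    let (N , K≤N) = archimedean K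
        (m , K≤m , m≤K+1) = ceiling N K≤N
    in suc m , ℚ.≤-trans K≤m (fromℕ-mono (ℕ.n≤1+n m)) , s≤s (fromℕ-cancel (ℚ.≤-trans 1≤K K≤m)) , (begin
      fromℕ (suc m)               ≡⟨ fromℕ-suc m ⟩
      1ℚ + fromℕ m                ≤⟨ ℚ.+-mono-≤ 1≤K (ℚ.≤-trans m≤K+1 (ℚ.+-monoˡ-≤ K 1≤K)) ⟩
      K + (K + K)                 ≡⟨ ≡.cong₂ _+_ (ℚ.*-identityˡ K) (≡.cong₂ _+_ (ℚ.*-identityˡ K) (ℚ.*-identityˡ K)) ⟨
      1ℚ * K + (1ℚ * K + 1ℚ * K)  ≡⟨ ≡.cong (1ℚ * K +_) (ℚ.*-distribʳ-+ K 1ℚ 1ℚ) ⟨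
      1ℚ * K + (1ℚ + 1ℚ) * K      ≡⟨ ℚ.*-distribʳ-+ K 1ℚ (1ℚ + 1ℚ) ⟨
      fromℕ 3 * K                 ∎)
    where open ℚ.≤-Reasoning

  1≤^ : ∀ e → 1ℚ ≤ K ^ e
  1≤^ zero = ℚ.≤-refl
  1≤^ (suc e) = *-mono-≤ 0≤1 0≤K 1≤K (1≤^ e)

  0≤^ : ∀ e → 0ℚ ≤ K ^ e
  0≤^ e = ℚ.≤-trans 0≤1 (1≤^ e)

  ^-mono : ∀ {e f} → e ℕ.≤ f → K ^ e ≤ K ^ f
  ^-mono {f = f} z≤n = 1≤^ f
  ^-mono {suc e} {suc f} (s≤s e≤f) = ℚ.*-monoˡ-≤-nonNeg K {{ℚ.nonNegative 0≤K}} (^-mono e≤f)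

  ^-bound : ∀ {κ} → fromℕ κ ≤ fromℕ 3 * K → ∀ e → fromℕ (κ ℕ.^ e) ≤ fromℕ (3 ℕ.^ e) * K ^ e
  ^-bound κ≤ zero = ℚ.≤-refl
  ^-bound {κ} κ≤ (suc e) = begin
    fromℕ (κ ℕ.* κ ℕ.^ e)                          ≡⟨ fromℕ-* κ (κ ℕ.^ e) ⟩
    fromℕ κ * fromℕ (κ ℕ.^ e)                      ≤⟨ *-mono-≤ (0≤fromℕ (κ ℕ.^ e)) (ℚ.≤-trans (0≤fromℕ κ) κ≤) κ≤ (^-bound κ≤ e) ⟩
    (fromℕ 3 * K) * (fromℕ (3 ℕ.^ e) * K ^ e)      ≡⟨ interchange (fromℕ 3) K (fromℕ (3 ℕ.^ e)) (K ^ e) ⟩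
    (fromℕ 3 * fromℕ (3 ℕ.^ e)) * (K * K ^ e)      ≡⟨ ≡.cong (_* (K * K ^ e)) (fromℕ-* 3 (3 ℕ.^ e)) ⟨
    fromℕ (3 ℕ.^ suc e) * K ^ suc e                ∎
    where
    open ℚ.≤-Reasoning
    open CommutativeSemigroupₚ
      (CommutativeMonoid.commutativeSemigroup ℚ.*-1-commutativeMonoid) using (interchange)

  -- κ^e ≤ 3^e K^e, so one number C above both e and 3^e serves as coefficient and as exponent.
  pow-bound : ∀ {κ} → 2 ℕ.≤ κ → fromℕ κ ≤ fromℕ 3 * K → ∀ {e m C} → m ℕ.≤ pow κ e → e ℕ.≤ C → pow 3 e ℕ.≤ C →
    fromℕ m ≤ fromℕ C * K ^ C
  pow-bound {κ} 2≤κ κ≤ {e} {m} {C} m≤ e≤C 3^e≤C = begin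
    fromℕ m                      ≤⟨ fromℕ-mono (ℕ.≤-trans m≤ (ℕ.≤-reflexive (pow≡^ κ e))) ⟩
    fromℕ (κ ℕ.^ e)              ≤⟨ ^-bound κ≤ e ⟩
    fromℕ (3 ℕ.^ e) * K ^ e      ≤⟨ *-mono-≤ (0≤^ e) (0≤fromℕ C) (fromℕ-mono (ℕ.≤-trans (ℕ.≤-reflexive (≡.sym (pow≡^ 3 e))) 3^e≤C)) (^-mono e≤C) ⟩
    fromℕ C * K ^ C              ∎
    where open ℚ.≤-Reasoning

n≤3^n : ∀ n → n ℕ.≤ 3 ℕ.^ n
n≤3^n zero = z≤n
n≤3^n (suc n) = ℕ.≤-trans (ℕ.+-mono-≤ (ℕ.m^n>0 3 n) (n≤3^n n)) (ℕ.+-monoʳ-≤ (3 ℕ.^ n) (ℕ.m≤m+n (3 ℕ.^ n) (3 ℕ.^ n ℕ.+ 0)))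

-- The largest exponent occurring is 2910, and the integer κ replacing K is at most 3K.
opaque

  constant : ℕ
  constant = 3 ℕ.^ 2910

  pow-3≤constant : ∀ {e} → e ℕ.≤ 2910 → pow 3 e ℕ.≤ constant
  pow-3≤constant e≤ = ℕ.≤-trans (pow-mono 3 (s≤s z≤n) e≤) (ℕ.≤-reflexive (pow≡^ 3 2910))

  ≤constant : ∀ {e} → e ℕ.≤ 2910 → e ℕ.≤ constant
  ≤constant e≤ = ℕ.≤-trans e≤ (n≤3^n 2910)

-- The dichotomy for subsets of a product of division rings

module Assembly (em : ∀ {a} → ExcludedMiddle a) {c ℓ p} (k : ℕ) (k≥1 : k ≥ 1) (D : Fin k → DivisionRing c ℓ)
  (A : Pred (Product.Carrier D) p) (n : ℕ) (card : Product.Card.∣_∣≡_ D A n) (nonempty : Satisfiable A)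
  (K : ℚ) (1≤K : 1ℚ ≤ K)
  (sums : Product.Card.∣_∣≤_ D (Product._⊕_ D A A) (K * fromℕ n))
  (products : Product.Card.∣_∣≤_ D (Product._⊙_ D A A) (K * fromℕ n)) where

  open Product D

  open Finite em
  open OnSetoid setoid using (∥_∥; ∥∥≤; dedup; dedup-unique; dedup⁺; dedup⁻; ∈⇒0<length; Unique) renaming (_∈_ to _∈ₗ_)
  private module R = Ring productRing
  open Sumsets em R.+-abelianGroup using (_⊞_; ⊞⁻)
  open ProductRing em D using (module Coordinate; ¬invertible-0; sparse)

  xs : List Carrier
  xs = proj₁ card

  xs! : Unique xs
  xs! = proj₁ (proj₂ card)

  length-xs : length xs ≡ n
  length-xs = proj₁ (proj₂ (proj₂ card))

  A⇒xs : ∀ {x} → A x → x ∈ₗ xs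
  A⇒xs {x} = Equivalence.to (proj₂ (proj₂ (proj₂ card)) x)

  xs⇒A : ∀ {x} → x ∈ₗ xs → A x
  xs⇒A {x} = Equivalence.from (proj₂ (proj₂ (proj₂ card)) x)

  κ : ℕ
  κ = proj₁ (natural-bound 1≤K)

  K≤κ : K ≤ fromℕ κ
  K≤κ = proj₁ (proj₂ (natural-bound 1≤K))

  2≤κ : 2 ℕ.≤ κ
  2≤κ = proj₁ (proj₂ (proj₂ (natural-bound 1≤K)))

  κ≤3K : fromℕ κ ≤ fromℕ 3 * K
  κ≤3K = proj₂ (proj₂ (proj₂ (natural-bound 1≤K)))

  1≤κ : 1 ℕ.≤ κ
  1≤κ = ℕ.≤-trans (s≤s z≤n) 2≤κ

  doubling : ∀ {q} {P : Pred Carrier q} zs → (∀ {x} → x ∈ₗ zs → P x) → Card.∣ P ∣≤ (K * fromℕ n) →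
    ∥ zs ∥ ℕ.≤ pow κ 1 ℕ.* length xs
  doubling zs sub (m , (ys , _ , refl′ , iff) , m≤) = ℕ.≤-trans (∥∥≤ (λ z∈ → Equivalence.to (iff _) (sub z∈)))
    (ℕ.≤-trans (ℕ.≤-reflexive refl′) (ℕ.≤-trans (fromℕ-cancel (ℚ.≤-trans m≤
      (ℚ.≤-trans (ℚ.*-monoʳ-≤-nonNeg (fromℕ n) {{nonNegative (0≤fromℕ n)}} K≤κ) (ℚ.≤-reflexive (≡.sym (fromℕ-* κ n))))))
      (ℕ.≤-reflexive (≡.cong₂ ℕ._*_ (≡.sym (pow-1 κ)) (≡.sym length-xs)))))

  sums′ : ∥ xs ⊞ xs ∥ ℕ.≤ pow κ 1 ℕ.* length xs
  sums′ = doubling (xs ⊞ xs) (λ z∈ → let (u , v , u∈ , v∈ , e) = ⊞⁻ xs xs z∈ in u , v , xs⇒A u∈ , xs⇒A v∈ , e) sums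

  products′ : ∥ cartesianProductWith R._*_ xs xs ∥ ℕ.≤ pow κ 1 ℕ.* length xs
  products′ = doubling (cartesianProductWith R._*_ xs xs) (λ z∈ →
    let (u , v , u∈ , v∈ , e) = Membershipₚ.∈-cartesianProductWith⁻ setoid setoid setoid R._*_ xs xs z∈
    in u , v , xs⇒A u∈ , xs⇒A v∈ , e) products

  bound : ∀ {e m} → e ℕ.≤ 2910 → m ℕ.≤ pow κ e → fromℕ m ≤ fromℕ constant * K ^ constant
  bound e≤ m≤ = pow-bound 1≤K 2≤κ κ≤3K m≤ (≤constant e≤) (pow-3≤constant e≤)

  bound-* : ∀ {e m l} → e ℕ.≤ 2910 → m ℕ.≤ pow κ e ℕ.* l → fromℕ m ≤ (fromℕ constant * K ^ constant) * fromℕ l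
  bound-* {e} {m} {l} e≤ m≤ = ℚ.≤-trans (fromℕ-mono m≤) (ℚ.≤-trans (ℚ.≤-reflexive (fromℕ-* (pow κ e) l))
    (ℚ.*-monoʳ-≤-nonNeg (fromℕ l) {{nonNegative (0≤fromℕ l)}} (bound e≤ ℕ.≤-refl)))

  coordinate-image : Fin k → ℕ
  coordinate-image j = Coordinate.∥_∥ j (map (λ x → x j) xs)

  small-image : ∀ j → coordinate-image j ℕ.≤ k ℕ.* pow κ 1453 →
    Cardᴰ.∣_∣≤_ j (π j A) (fromℕ constant * fromℕ k * K ^ constant)
  small-image j le = coordinate-image j
    , (Coordinate.dedup j (map (λ x → x j) xs) , Coordinate.dedup-unique j _ , ≡.refl , λ y → mk⇔ to from)
    , ℚ.≤-trans (bound-* {e = 1453} (ℕ.≤ᵇ⇒≤ 1453 2910 tt) (ℕ.≤-trans le (ℕ.≤-reflexive (ℕ.*-comm k (pow κ 1453)))))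
        (ℚ.≤-reflexive rearrange)
    where
    to : ∀ {y} → π j A y → _
    to (x , x∈A , e) = Coordinate.dedup⁺ j (Coordinate.∈-resp j (D.sym j e)
      (Membershipₚ.∈-map⁺ setoid (D.setoid j) (λ q → q j) (A⇒xs x∈A)))
    from : ∀ {y} → _ → π j A y
    from y∈ = let (x , x∈ , e) = Membershipₚ.∈-map⁻ setoid (D.setoid j) (Coordinate.dedup⁻ j y∈) in x , xs⇒A x∈ , e
    rearrange : (fromℕ constant * K ^ constant) * fromℕ k ≡ fromℕ constant * fromℕ k * K ^ constant
    rearrange = ≡.trans (ℚ.*-assoc (fromℕ constant) (K ^ constant) (fromℕ k))
      (≡.trans (≡.cong (fromℕ constant *_) (ℚ.*-comm (K ^ constant) (fromℕ k))) (≡.sym (ℚ.*-assoc (fromℕ constant) (fromℕ k) (K ^ constant))))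

  Conclusion : Set _
  Conclusion =
    Σ[ S ∈ Pred Carrier (c ⊔ ℓ) ]
      IsSubring S
      × Card.∣ S ∣≤ (fromℕ constant * K ^ constant * fromℕ n)
      × (∃[ a ] a ∈ A × IsInvertible a × (a ·ˡ S) ≐ (S ·ʳ a)
          × (Σ[ X ∈ Pred Carrier (c ⊔ ℓ) ]
              Satisfiable X
              × Card.∣ X ∣≤ (fromℕ constant * K ^ constant)
              × A ⊆ (a ·ˡ S) ⊕ X))

  open SumProduct em κ 2≤κ productRing using (Structured; structure)

  from-structure : Structured xs → Conclusion
  from-structure st = S , subring
    , (length elements , (elements , unique , ≡.refl , enumerates)
      , bound-* {e = 2910} ℕ.≤-refl (≡.subst (λ z → length elements ℕ.≤ pow κ 2910 ℕ.* z) length-xs small))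
    , a , xs⇒A a∈A , invertible , normalises
    , (_∈ₗ shifts) , Structured.nonempty st
    , (length (dedup shifts) , (dedup shifts , dedup-unique shifts , ≡.refl , λ x → mk⇔ dedup⁺ dedup⁻)
      , bound {e = 8} (ℕ.≤ᵇ⇒≤ 8 2910 tt) (ℕ.≤-trans (∥∥≤ {shifts} {shifts} id) few))
    , λ x∈ → let (s , y , p , q , e) = covers (A⇒xs x∈) in a R.* s , y , (s , p , R.refl) , q , e
    where open Structured st hiding (nonempty)

  -- A coordinate in which 0 and 1 differ: it makes 0 non-invertible in the product ring.
  first-coordinate : ∀ {k} → k ≥ 1 → Fin k
  first-coordinate (s≤s _) = zero

  0<xs : 0 ℕ.< length xs
  0<xs = ∈⇒0<length (A⇒xs (proj₂ nonempty))

  dichotomy : Dec (∃[ j ] coordinate-image j ℕ.≤ k ℕ.* pow κ 1453) →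
    (∃[ j ] Cardᴰ.∣_∣≤_ j (π j A) (fromℕ constant * fromℕ k * K ^ constant)) ⊎ Conclusion
  dichotomy (yes (j , le)) = inj₁ (j , small-image j le)
  dichotomy (no none) = inj₂ (from-structure (structure xs xs! 0<xs sums′ products′ (¬invertible-0 (first-coordinate k≥1))
    (sparse κ 1≤κ xs xs! sums′ λ j → ℕ.<⇒≤ (ℕ.≰⇒> λ le → none (j , le)))))

theorem5p4 :
    ∃ω ℕ λ C →
    (∀ {a} → ExcludedMiddle a) →
    ∀ {c ℓ p} (k : ℕ) → k ≥ 1 →
    (D : Fin k → DivisionRing c ℓ) →
    let open Product D in
    (A : Pred Carrier p) (n : ℕ) → Card.∣ A ∣≡ n → Satisfiable A →
    (K : ℚ) → 1ℚ ≤ K →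
    Card.∣ A ⊕ A ∣≤ (K * fromℕ n) →
    Card.∣ A ⊙ A ∣≤ (K * fromℕ n) →
    (∃[ j ] Cardᴰ.∣_∣≤_ j (π j A) (fromℕ C * fromℕ k * K ^ C))
    ⊎
    (Σ[ S ∈ Pred Carrier (c ⊔ ℓ) ]
      IsSubring S
      × Card.∣ S ∣≤ (fromℕ C * K ^ C * fromℕ n)
      × (∃[ a ] a ∈ A × IsInvertible a × (a ·ˡ S) ≐ (S ·ʳ a)
          × (Σ[ X ∈ Pred Carrier (c ⊔ ℓ) ]
              Satisfiable X
              × Card.∣ X ∣≤ (fromℕ C * K ^ C)
              × A ⊆ (a ·ˡ S) ⊕ X)))
theorem5p4 = constant ,ω λ em k k≥1 D A n card nonempty K 1≤K sums products →
  Assembly.dichotomy em k k≥1 D A n card nonempty K 1≤K sums products em
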